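{- Let $k \geq 3$ be an integer, and let $f : \mathbb{N} \rightarrow \mathbb{C}$ be a function satisfying $$f(x_1^2 + \cdots + x_k^2) = f(x_1)^2 + \cdots + f(x_k)^2 \quad \text{for all } x_1, \ldots, x_k \in \mathbb{N}.$$ Then one of the following holds: (1) $f(n) = 0$ for all $n \in \mathbb{N}$; (2) for every $n \in \mathbb{N}$: $f(n) = n$ if there exist $x_1, \ldots, x_k \in \mathbb{N}$ with $n = x_1^2 + \cdots + x_k^2$, and $f(n) \in \{n, -n\}$ otherwise (the sign being chosen independently for each such $n$); (3) for every $n \in \mathbb{N}$: $f(n) = \frac{1}{k}$ if there exist $x_1, \ldots, x_k \in \mathbb{N}$ with $n = x_1^2 + \cdots + x_k^2$, and $f(n) \in \{\frac{1}{k}, -\frac{1}{k}\}$ otherwise (the sign being chosen independently for each such $n$).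
   Context: $\mathbb{N}$ denotes the set of positive integers (so $0 \notin \mathbb{N}$). The function $f$ is an arbitrary function; no multiplicativity is assumed. -}

module Defs where

open import Algebra.Bundles using (CommutativeMonoid; RawRing)
import Algebra.Definitions.RawMonoid as RawMonoidDefs
import Algebra.Properties.AbelianGroup as AbelianGroupₚ
import Algebra.Properties.CommutativeSemigroup as CommutativeSemigroupₚ
import Algebra.Properties.Group as Groupₚ
open import Data.Fin.Base as Fin using ()
open import Data.Integer.Base using (+_)
open import Data.Nat.Base as ℕ using (ℕ; suc)
import Data.Nat.Properties as ℕₚ
open import Data.Product.Base using (_×_; _,_; ∃-syntax)
open import Data.Rational.Base as ℚ using (ℚ; 0ℚ; 1ℚ; ½; ∣_∣; _/_)
import Data.Rational.Properties as ℚₚ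
open import Data.Vec.Functional using (Vector)
open import Level using (0ℓ)
open import Relation.Binary.PropositionalEquality
  using (_≡_; sym; trans; cong; cong₂; subst; module ≡-Reasoning)

-- The proof of positivity is irrelevant, so that propositional equality on ℕ⁺
-- is equality of the underlying natural numbers.
record ℕ⁺ : Set where
  constructor mkℕ⁺
  field
    toℕ          : ℕ
    .{{nonZero}} : ℕ.NonZero toℕ

open ℕ⁺ public using (toℕ)

sumSq : ∀ {k} → Vector ℕ⁺ k → ℕ
sumSq x = RawMonoidDefs.sum ℕ.+-0-rawMonoid (λ i → toℕ (x i) ℕ.^ 2)

sumSq-nonZero : ∀ {k} .{{_ : ℕ.NonZero k}} (x : Vector ℕ⁺ k) → ℕ.NonZero (sumSq x)
sumSq-nonZero {suc k} x with x Fin.zero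
... | mkℕ⁺ (suc m) = _

sumOfSquares : ∀ {k} .{{_ : ℕ.NonZero k}} → Vector ℕ⁺ k → ℕ⁺
sumOfSquares x = mkℕ⁺ (sumSq x) {{sumSq-nonZero x}}

IsSumOfSquares : (k : ℕ) .{{_ : ℕ.NonZero k}} → ℕ⁺ → Set
IsSumOfSquares k n = ∃[ x ] n ≡ sumOfSquares {k} x

-- ℝ is the setoid of Cauchy sequences of rationals, two sequences being equal
-- (_≈ᵣ_) when their difference tends to 0.  Operations are termwise.

IsCauchy : (ℕ → ℚ) → Set
IsCauchy x = ∀ ε → 0ℚ ℚ.< ε →
  ∃[ N ] (∀ m n → N ℕ.≤ m → N ℕ.≤ n → ∣ x m ℚ.- x n ∣ ℚ.< ε)

record ℝ : Set where
  constructor mkℝ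
  field
    seq    : ℕ → ℚ
    cauchy : IsCauchy seq

open ℝ public

infix 4 _≈ᵣ_
_≈ᵣ_ : ℝ → ℝ → Set
x ≈ᵣ y = ∀ ε → 0ℚ ℚ.< ε → ∃[ N ] (∀ n → N ℕ.≤ n → ∣ seq x n ℚ.- seq y n ∣ ℚ.< ε)

½*-pos : ∀ {ε} → 0ℚ ℚ.< ε → 0ℚ ℚ.< ½ ℚ.* ε
½*-pos {ε} 0<ε = subst (ℚ._< ½ ℚ.* ε) (ℚₚ.*-zeroʳ ½) (ℚₚ.*-monoʳ-<-pos ½ 0<ε)

½*+½* : ∀ ε → ½ ℚ.* ε ℚ.+ ½ ℚ.* ε ≡ ε
½*+½* ε = trans (sym (ℚₚ.*-distribʳ-+ ε ½ ½)) (ℚₚ.*-identityˡ ε)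

+-difference : ∀ a b c d → (a ℚ.+ b) ℚ.- (c ℚ.+ d) ≡ (a ℚ.- c) ℚ.+ (b ℚ.- d)
+-difference a b c d = trans (cong ((a ℚ.+ b) ℚ.+_) (ℚₚ.neg-distrib-+ c d))
  (interchange a b (ℚ.- c) (ℚ.- d))
  where open CommutativeSemigroupₚ
          (CommutativeMonoid.commutativeSemigroup ℚₚ.+-0-commutativeMonoid)

*-difference : ∀ a b c d → a ℚ.* b ℚ.- c ℚ.* d ≡ a ℚ.* (b ℚ.- d) ℚ.+ d ℚ.* (a ℚ.- c)
*-difference a b c d = sym (begin
  a ℚ.* (b ℚ.- d) ℚ.+ d ℚ.* (a ℚ.- c)
    ≡⟨ cong₂ ℚ._+_ (distrib a b d) (distrib d a c) ⟩
  (a ℚ.* b ℚ.- a ℚ.* d) ℚ.+ (d ℚ.* a ℚ.- d ℚ.* c)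
    ≡⟨ cong₂ (λ u v → (a ℚ.* b ℚ.- a ℚ.* d) ℚ.+ (u ℚ.- v)) (ℚₚ.*-comm d a) (ℚₚ.*-comm d c) ⟩
  (a ℚ.* b ℚ.- a ℚ.* d) ℚ.+ (a ℚ.* d ℚ.- c ℚ.* d)
    ≡⟨ ℚₚ.+-assoc (a ℚ.* b) (ℚ.- (a ℚ.* d)) (a ℚ.* d ℚ.- c ℚ.* d) ⟩
  a ℚ.* b ℚ.+ (ℚ.- (a ℚ.* d) ℚ.+ (a ℚ.* d ℚ.- c ℚ.* d))
    ≡⟨ cong (a ℚ.* b ℚ.+_) (\\-leftDividesʳ (a ℚ.* d) (ℚ.- (c ℚ.* d))) ⟩
  a ℚ.* b ℚ.- c ℚ.* d ∎)
  where
  open ≡-Reasoning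
  open Groupₚ ℚₚ.+-0-group using (\\-leftDividesʳ)
  distrib : ∀ p q r → p ℚ.* (q ℚ.- r) ≡ p ℚ.* q ℚ.- p ℚ.* r
  distrib p q r = trans (ℚₚ.*-distribˡ-+ p q (ℚ.- r))
    (cong (p ℚ.* q ℚ.+_) (sym (ℚₚ.neg-distribʳ-* p r)))

neg-difference : ∀ a c → (ℚ.- a) ℚ.- (ℚ.- c) ≡ ℚ.- (a ℚ.- c)
neg-difference a c = sym (ℚₚ.neg-distrib-+ a (ℚ.- c))

split : ∀ a c → a ≡ c ℚ.+ (a ℚ.- c)
split a c = trans (sym (xyx⁻¹≈y c a)) (ℚₚ.+-assoc c a (ℚ.- c))
  where open AbelianGroupₚ ℚₚ.+-0-abelianGroup using (xyx⁻¹≈y)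

-- If B > 0 then δ = ε / B satisfies 0 < δ and |a||b| < ε whenever |a| ≤ B and |b| < δ.
scale : ∀ B → 0ℚ ℚ.< B → ∀ ε → 0ℚ ℚ.< ε →
  ∃[ δ ] (0ℚ ℚ.< δ × (∀ a b → ∣ a ∣ ℚ.≤ B → ∣ b ∣ ℚ.< δ → ∣ a ℚ.* b ∣ ℚ.< ε))
scale B 0<B ε 0<ε = δ , 0<δ , bound
  where
  instance
    B-pos : ℚ.Positive B
    B-pos = ℚ.positive 0<B
    B-nonZero : ℚ.NonZero B
    B-nonZero = ℚₚ.pos⇒nonZero B
    1/B-pos : ℚ.Positive (ℚ.1/ B)
    1/B-pos = ℚₚ.1/pos⇒pos B
  δ : ℚ
  δ = ℚ.1/ B ℚ.* ε
  0<δ : 0ℚ ℚ.< δ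
  0<δ = subst (ℚ._< δ) (ℚₚ.*-zeroʳ (ℚ.1/ B)) (ℚₚ.*-monoʳ-<-pos (ℚ.1/ B) 0<ε)
  bound : ∀ a b → ∣ a ∣ ℚ.≤ B → ∣ b ∣ ℚ.< δ → ∣ a ℚ.* b ∣ ℚ.< ε
  bound a b a≤B b<δ = begin-strict
    ∣ a ℚ.* b ∣            ≡⟨ ℚₚ.∣p*q∣≡∣p∣*∣q∣ a b ⟩
    ∣ a ∣ ℚ.* ∣ b ∣        ≤⟨ ℚₚ.*-monoʳ-≤-nonNeg ∣ b ∣ {{ℚₚ.∣-∣-nonNeg b}} a≤B ⟩
    B ℚ.* ∣ b ∣            <⟨ ℚₚ.*-monoʳ-<-pos B b<δ ⟩
    B ℚ.* (ℚ.1/ B ℚ.* ε)   ≡⟨ sym (ℚₚ.*-assoc B (ℚ.1/ B) ε) ⟩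
    (B ℚ.* ℚ.1/ B) ℚ.* ε   ≡⟨ cong (ℚ._* ε) (ℚₚ.*-inverseʳ B) ⟩
    1ℚ ℚ.* ε               ≡⟨ ℚₚ.*-identityˡ ε ⟩
    ε                      ∎
    where open ℚₚ.≤-Reasoning

eventuallyBounded : ∀ x → IsCauchy x →
  ∃[ B ] (0ℚ ℚ.< B × ∃[ N ] (∀ n → N ℕ.≤ n → ∣ x n ∣ ℚ.≤ B))
eventuallyBounded x cx with cx 1ℚ (ℚₚ.positive⁻¹ 1ℚ)
... | N , close = ∣ x N ∣ ℚ.+ 1ℚ , B>0 , N , bound
  where
  open ℚₚ.≤-Reasoning
  B>0 : 0ℚ ℚ.< ∣ x N ∣ ℚ.+ 1ℚ
  B>0 = ℚₚ.+-mono-≤-< (ℚₚ.0≤∣p∣ (x N)) (ℚₚ.positive⁻¹ 1ℚ)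
  bound : ∀ n → N ℕ.≤ n → ∣ x n ∣ ℚ.≤ ∣ x N ∣ ℚ.+ 1ℚ
  bound n N≤n = begin
    ∣ x n ∣                          ≡⟨ cong ∣_∣ (split (x n) (x N)) ⟩
    ∣ x N ℚ.+ (x n ℚ.- x N) ∣        ≤⟨ ℚₚ.∣p+q∣≤∣p∣+∣q∣ (x N) (x n ℚ.- x N) ⟩
    ∣ x N ∣ ℚ.+ ∣ x n ℚ.- x N ∣      ≤⟨ ℚₚ.+-monoʳ-≤ ∣ x N ∣ (ℚₚ.<⇒≤ (close n N N≤n ℕₚ.≤-refl)) ⟩
    ∣ x N ∣ ℚ.+ 1ℚ                   ∎

∣+∣<ε : ∀ ε a b → ∣ a ∣ ℚ.< ½ ℚ.* ε → ∣ b ∣ ℚ.< ½ ℚ.* ε → ∣ a ℚ.+ b ∣ ℚ.< ε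
∣+∣<ε ε a b a< b< = begin-strict
  ∣ a ℚ.+ b ∣              ≤⟨ ℚₚ.∣p+q∣≤∣p∣+∣q∣ a b ⟩
  ∣ a ∣ ℚ.+ ∣ b ∣          <⟨ ℚₚ.+-mono-< a< b< ⟩
  ½ ℚ.* ε ℚ.+ ½ ℚ.* ε      ≡⟨ ½*+½* ε ⟩
  ε                        ∎
  where open ℚₚ.≤-Reasoning

+-cauchy : ∀ x y → IsCauchy x → IsCauchy y → IsCauchy (λ n → x n ℚ.+ y n)
+-cauchy x y cx cy ε 0<ε
  with cx (½ ℚ.* ε) (½*-pos 0<ε) | cy (½ ℚ.* ε) (½*-pos 0<ε)
... | M , hx | N , hy = M ℕ.⊔ N , λ m n ≤m ≤n →
  subst (λ z → ∣ z ∣ ℚ.< ε) (sym (+-difference (x m) (y m) (x n) (y n)))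
    (∣+∣<ε ε (x m ℚ.- x n) (y m ℚ.- y n)
      (hx m n (ℕₚ.m⊔n≤o⇒m≤o M N ≤m) (ℕₚ.m⊔n≤o⇒m≤o M N ≤n))
      (hy m n (ℕₚ.m⊔n≤o⇒n≤o M N ≤m) (ℕₚ.m⊔n≤o⇒n≤o M N ≤n)))

neg-cauchy : ∀ x → IsCauchy x → IsCauchy (λ n → ℚ.- x n)
neg-cauchy x cx ε 0<ε with cx ε 0<ε
... | N , h = N , λ m n ≤m ≤n →
  subst (ℚ._< ε)
    (sym (trans (cong ∣_∣ (neg-difference (x m) (x n))) (ℚₚ.∣-p∣≡∣p∣ (x m ℚ.- x n))))
    (h m n ≤m ≤n)

*-cauchy : ∀ x y → IsCauchy x → IsCauchy y → IsCauchy (λ n → x n ℚ.* y n)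
*-cauchy x y cx cy ε 0<ε
  with eventuallyBounded x cx | eventuallyBounded y cy
... | B , 0<B , K , x≤B | C , 0<C , L , y≤C
  with scale B 0<B (½ ℚ.* ε) (½*-pos 0<ε) | scale C 0<C (½ ℚ.* ε) (½*-pos 0<ε)
... | δ , 0<δ , hδ | η , 0<η , hη
  with cy δ 0<δ | cx η 0<η
... | M , hy | N , hx = (K ℕ.⊔ L) ℕ.⊔ (M ℕ.⊔ N) , λ m n ≤m ≤n →
  subst (λ z → ∣ z ∣ ℚ.< ε) (sym (*-difference (x m) (y m) (x n) (y n)))
    (∣+∣<ε ε (x m ℚ.* (y m ℚ.- y n)) (y n ℚ.* (x m ℚ.- x n))
      (hδ (x m) (y m ℚ.- y n) (x≤B m (≥K ≤m)) (hy m n (≥M ≤m) (≥M ≤n)))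
      (hη (y n) (x m ℚ.- x n) (y≤C n (≥L ≤n)) (hx m n (≥N ≤m) (≥N ≤n))))
  where
  ≥K : ∀ {n} → (K ℕ.⊔ L) ℕ.⊔ (M ℕ.⊔ N) ℕ.≤ n → K ℕ.≤ n
  ≥K p = ℕₚ.m⊔n≤o⇒m≤o K L (ℕₚ.m⊔n≤o⇒m≤o (K ℕ.⊔ L) (M ℕ.⊔ N) p)
  ≥L : ∀ {n} → (K ℕ.⊔ L) ℕ.⊔ (M ℕ.⊔ N) ℕ.≤ n → L ℕ.≤ n
  ≥L p = ℕₚ.m⊔n≤o⇒n≤o K L (ℕₚ.m⊔n≤o⇒m≤o (K ℕ.⊔ L) (M ℕ.⊔ N) p)
  ≥M : ∀ {n} → (K ℕ.⊔ L) ℕ.⊔ (M ℕ.⊔ N) ℕ.≤ n → M ℕ.≤ n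
  ≥M p = ℕₚ.m⊔n≤o⇒m≤o M N (ℕₚ.m⊔n≤o⇒n≤o (K ℕ.⊔ L) (M ℕ.⊔ N) p)
  ≥N : ∀ {n} → (K ℕ.⊔ L) ℕ.⊔ (M ℕ.⊔ N) ℕ.≤ n → N ℕ.≤ n
  ≥N p = ℕₚ.m⊔n≤o⇒n≤o M N (ℕₚ.m⊔n≤o⇒n≤o (K ℕ.⊔ L) (M ℕ.⊔ N) p)

const-cauchy : ∀ q → IsCauchy (λ _ → q)
const-cauchy q ε 0<ε = 0 , λ _ _ _ _ →
  subst (ℚ._< ε) (sym (cong ∣_∣ (ℚₚ.+-inverseʳ q))) 0<ε

infixl 6 _+ᵣ_ _-ᵣ_
infixl 7 _*ᵣ_
infix  8 -ᵣ_

_+ᵣ_ : ℝ → ℝ → ℝ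
x +ᵣ y = mkℝ (λ n → seq x n ℚ.+ seq y n) (+-cauchy (seq x) (seq y) (cauchy x) (cauchy y))

_*ᵣ_ : ℝ → ℝ → ℝ
x *ᵣ y = mkℝ (λ n → seq x n ℚ.* seq y n) (*-cauchy (seq x) (seq y) (cauchy x) (cauchy y))

-ᵣ_ : ℝ → ℝ
-ᵣ x = mkℝ (λ n → ℚ.- seq x n) (neg-cauchy (seq x) (cauchy x))

_-ᵣ_ : ℝ → ℝ → ℝ
x -ᵣ y = x +ᵣ (-ᵣ y)

ℚ⇒ℝ : ℚ → ℝ
ℚ⇒ℝ q = mkℝ (λ _ → q) (const-cauchy q)

record ℂ : Set where
  constructor _+i_
  field
    re im : ℝ

open ℂ public

infix  4 _≈_
infixl 6 _+_
infixl 7 _*_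
infix  8 -_
infix  9 _²

_≈_ : ℂ → ℂ → Set
z ≈ w = re z ≈ᵣ re w × im z ≈ᵣ im w

_+_ : ℂ → ℂ → ℂ
z + w = (re z +ᵣ re w) +i (im z +ᵣ im w)

_*_ : ℂ → ℂ → ℂ
z * w = (re z *ᵣ re w -ᵣ im z *ᵣ im w) +i (re z *ᵣ im w +ᵣ im z *ᵣ re w)

-_ : ℂ → ℂ
- z = (-ᵣ re z) +i (-ᵣ im z)

_² : ℂ → ℂ
z ² = z * z

ℚ⇒ℂ : ℚ → ℂ
ℚ⇒ℂ q = ℚ⇒ℝ q +i ℚ⇒ℝ 0ℚ

0ℂ 1ℂ : ℂ
0ℂ = ℚ⇒ℂ 0ℚ
1ℂ = ℚ⇒ℂ 1ℚ

ℂ-rawRing : RawRing 0ℓ 0ℓ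
ℂ-rawRing = record
  { Carrier = ℂ ; _≈_ = _≈_ ; _+_ = _+_ ; _*_ = _*_ ; -_ = -_ ; 0# = 0ℂ ; 1# = 1ℂ }

∑ : ∀ {k} → Vector ℂ k → ℂ
∑ = RawMonoidDefs.sum (RawRing.+-rawMonoid ℂ-rawRing)

ℕ⁺⇒ℂ : ℕ⁺ → ℂ
ℕ⁺⇒ℂ n = ℚ⇒ℂ (+ toℕ n / 1)

1/ℂ : (k : ℕ) .{{_ : ℕ.NonZero k}} → ℂ
1/ℂ k = ℚ⇒ℂ (+ 1 / k)

{-# OPTIONS --safe #-}

-- Let g = f².  Completing (a, b, c) by k − 3 twos shows that g a + g b + g c
-- depends only on a² + b² + c², and coincidences between sums of three squares
-- force g n = A n² + B + C [n odd]; the parity term cannot be excluded at this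
-- stage, since for k = 3 the sum of squares modulo 4 determines the number of odd
-- entries.  Now g N = f(N)² becomes A N² + B + C [N odd] = (A N + k B + j C)² when
-- N is a sum of k squares, j of them odd.  Comparing a few such N gives
-- A² = A, A (k B) = 0, B = (k B)² and C = 0, so A and k² B are idempotents.
-- In ℂ an idempotent is 0 or 1, and constructively one can tell which, because a
-- close enough approximation separates 0 from 1.  This decides between the three
-- cases, and the sign of f n is decided in the same way: if z² = v² with v
-- invertible, then (z / v + 1) / 2 is idempotent.
module Submission where

open import Algebra.Bundles using (CommutativeRing; RawRing)
open import Algebra.Consequences.Setoid
  using (comm∧idˡ⇒id; comm∧invˡ⇒inv; comm∧distrˡ⇒distr)
import Algebra.Properties.CommutativeMonoid.Sum as MonoidSum
import Algebra.Properties.Group as GroupProperties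
import Algebra.Solver.Ring as RingSolver
open import Algebra.Solver.Ring.AlmostCommutativeRing
  using (fromCommutativeRing; _-Raw-AlmostCommutative⟶_)
open import Data.Fin.Base using (Fin; zero; suc)
open import Data.Integer.Base as ℤ using (+_)
import Data.Integer.Properties as ℤₚ
import Data.Maybe.Base as Maybe
open import Data.Nat.Base as ℕ using (ℕ; zero; suc; _≥_; >-nonZero; z≤n; s≤s)
open import Data.Nat.Induction using (<-rec)
open import Data.Nat.Properties as ℕₚ using (≤-trans)
import Data.Nat.Solver as ℕ-Solver
open import Data.Nat.Tactic.RingSolver using (solve-∀)
open import Data.Product.Base using (_×_; _,_; proj₁; proj₂; ∃-syntax)
open import Data.Rational.Base as ℚ using (ℚ; 0ℚ; 1ℚ; ½; ∣_∣; _/_)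
import Data.Rational.Properties as ℚₚ
open import Data.Rational.Solver using (module +-*-Solver)
open import Data.Rational.Unnormalised.Base as ℚᵘ using (*≡*; mkℚᵘ)
import Data.Rational.Unnormalised.Properties as ℚᵘₚ
open import Data.Sum.Base as Sum using (_⊎_; inj₁; inj₂; [_,_]′)
open import Data.Vec.Functional using (Vector; _∷_; replicate)
open import Defs hiding (_≈_; _+_; _*_; -_; _²)
open import Function.Base using (id)
open import Level using (0ℓ)
open import Relation.Binary.Bundles using (Setoid)
open import Relation.Binary.PropositionalEquality as ≡ using (_≡_)
import Relation.Binary.Reasoning.Setoid as SetoidReasoning
open import Relation.Nullary.Decidable using (dec⇒maybe)
open import Relation.Nullary.Negation.Core using (¬_)

-- Natural numbers and their reciprocals in ℚ.

toℚᵘ-/1 : ∀ n → ℚ.toℚᵘ (+ n / 1) ℚᵘ.≃ mkℚᵘ (+ n) 0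
toℚᵘ-/1 n = ℚₚ.toℚᵘ-fromℚᵘ (mkℚᵘ (+ n) 0)

-- `_/_` normalises by a gcd, so this identity and the next two are checked among unnormalised
-- fractions.
/1-+ : ∀ m n → + (m ℕ.+ n) / 1 ≡ (+ m / 1) ℚ.+ (+ n / 1)
/1-+ m n = ℚₚ.toℚᵘ-injective (begin
  ℚ.toℚᵘ (+ (m ℕ.+ n) / 1)                    ≈⟨ toℚᵘ-/1 (m ℕ.+ n) ⟩
  mkℚᵘ (+ (m ℕ.+ n)) 0
    ≈⟨ *≡* (≡.cong (ℤ._* + 1) (≡.sym
         (≡.cong₂ ℤ._+_ (ℤₚ.*-identityʳ (+ m)) (ℤₚ.*-identityʳ (+ n))))) ⟩
  mkℚᵘ (+ m) 0 ℚᵘ.+ mkℚᵘ (+ n) 0              ≈⟨ ℚᵘₚ.+-cong (toℚᵘ-/1 m) (toℚᵘ-/1 n) ⟨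
  ℚ.toℚᵘ (+ m / 1) ℚᵘ.+ ℚ.toℚᵘ (+ n / 1)      ≈⟨ ℚₚ.toℚᵘ-homo-+ (+ m / 1) (+ n / 1) ⟨
  ℚ.toℚᵘ ((+ m / 1) ℚ.+ (+ n / 1))            ∎)
  where open SetoidReasoning ℚᵘₚ.≃-setoid

/1-* : ∀ m n → + (m ℕ.* n) / 1 ≡ (+ m / 1) ℚ.* (+ n / 1)
/1-* m n = ℚₚ.toℚᵘ-injective (begin
  ℚ.toℚᵘ (+ (m ℕ.* n) / 1)                    ≈⟨ toℚᵘ-/1 (m ℕ.* n) ⟩
  mkℚᵘ (+ (m ℕ.* n)) 0                        ≈⟨ *≡* (≡.cong (ℤ._* + 1) (ℤₚ.pos-* m n)) ⟩
  mkℚᵘ (+ m) 0 ℚᵘ.* mkℚᵘ (+ n) 0              ≈⟨ ℚᵘₚ.*-cong (toℚᵘ-/1 m) (toℚᵘ-/1 n) ⟨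
  ℚ.toℚᵘ (+ m / 1) ℚᵘ.* ℚ.toℚᵘ (+ n / 1)      ≈⟨ ℚₚ.toℚᵘ-homo-* (+ m / 1) (+ n / 1) ⟨
  ℚ.toℚᵘ ((+ m / 1) ℚ.* (+ n / 1))            ∎)
  where open SetoidReasoning ℚᵘₚ.≃-setoid

1/n*n : ∀ n .{{_ : ℕ.NonZero n}} → (+ 1 / n) ℚ.* (+ n / 1) ≡ 1ℚ
1/n*n n@(suc n-1) = ℚₚ.toℚᵘ-injective (begin
  ℚ.toℚᵘ ((+ 1 / n) ℚ.* (+ n / 1))            ≈⟨ ℚₚ.toℚᵘ-homo-* (+ 1 / n) (+ n / 1) ⟩
  ℚ.toℚᵘ (+ 1 / n) ℚᵘ.* ℚ.toℚᵘ (+ n / 1)      ≈⟨ ℚᵘₚ.*-cong (ℚₚ.toℚᵘ-fromℚᵘ (mkℚᵘ (+ 1) n-1)) (toℚᵘ-/1 n) ⟩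
  mkℚᵘ (+ 1) n-1 ℚᵘ.* mkℚᵘ (+ n) 0            ≈⟨ *≡* (ℤₚ.*-assoc (+ 1) (+ n) (+ 1)) ⟩
  ℚ.toℚᵘ 1ℚ                                   ∎)
  where open SetoidReasoning ℚᵘₚ.≃-setoid

-- Parity, and coincidences between sums of squares.

odd : ℕ → ℕ
odd 0             = 0
odd 1             = 1
-- Recursion in steps of two makes `odd (3 + t)` and `odd (7 + t)` the same term by computation, and
-- lets each square 4 disappear from the parity of a sum.
odd (suc (suc n)) = odd n

halve : ∀ n → ∃[ t ] (n ≡ t ℕ.+ t ⊎ n ≡ suc (t ℕ.+ t))
halve zero    = 0 , inj₁ ≡.refl
halve (suc n) with halve n
... | t , inj₁ n≡2t   = t , inj₂ (≡.cong suc n≡2t)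
... | t , inj₂ n≡2t+1 = suc t , inj₁ (≡.cong suc (≡.trans n≡2t+1 (≡.sym (ℕₚ.+-suc t t))))

2⁺ : ℕ⁺
2⁺ = mkℕ⁺ 2

twos : ∀ n → Vector ℕ⁺ n
twos n = replicate n 2⁺

odd-twos : ∀ n → odd (sumSq (twos n)) ≡ 0
odd-twos zero    = ≡.refl
odd-twos (suc n) = odd-twos n

odd-suc-twos : ∀ n → odd (suc (sumSq (twos n))) ≡ 1
odd-suc-twos zero    = ≡.refl
odd-suc-twos (suc n) = odd-suc-twos n

-- The two families come from (2n + c)² + (n − 2c)² = (2n − c)² + (n + 2c)²
-- with c = 1 and c = 2.
module _ where
  open ℕ-Solver.+-*-Solver

  odd-family : ∀ t → 1 ℕ.+ ((3 ℕ.+ t) ℕ.^ 2 ℕ.+ (11 ℕ.+ (t ℕ.+ t)) ℕ.^ 2) ≡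
                     1 ℕ.+ ((7 ℕ.+ t) ℕ.^ 2 ℕ.+ (9 ℕ.+ (t ℕ.+ t)) ℕ.^ 2)
  odd-family = solve 1 (λ t →
    con 1 :+ ((con 3 :+ t) :^ 2 :+ (con 11 :+ (t :+ t)) :^ 2) :=
    con 1 :+ ((con 7 :+ t) :^ 2 :+ (con 9 :+ (t :+ t)) :^ 2)) ≡.refl

  even-family : ∀ t → 1 ℕ.+ ((1 ℕ.+ t) ℕ.^ 2 ℕ.+ (12 ℕ.+ (t ℕ.+ t)) ℕ.^ 2) ≡
                      1 ℕ.+ ((9 ℕ.+ t) ℕ.^ 2 ℕ.+ (8 ℕ.+ (t ℕ.+ t)) ℕ.^ 2)
  even-family = solve 1 (λ t →
    con 1 :+ ((con 1 :+ t) :^ 2 :+ (con 12 :+ (t :+ t)) :^ 2) :=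
    con 1 :+ ((con 9 :+ t) :^ 2 :+ (con 8 :+ (t :+ t)) :^ 2)) ≡.refl

-- Algebras over ℚ.

ℚ-rawRing : RawRing 0ℓ 0ℓ
ℚ-rawRing = CommutativeRing.rawRing ℚₚ.+-*-commutativeRing

-- The algebra is done in any commutative ring receiving ℚ, with a solver for polynomials with
-- rational coefficients. The only further facts about ℂ enter later, as `idempotent` and `reduced`.
module ℚ-Algebra {c ℓ} (R : CommutativeRing c ℓ)
  (homomorphism : ℚ-rawRing -Raw-AlmostCommutative⟶ fromCommutativeRing R)
  where

  open CommutativeRing R public hiding (zero)
  open _-Raw-AlmostCommutative⟶_ homomorphism public
  open RingSolver ℚ-rawRing (fromCommutativeRing R) homomorphism
    (λ p q → Maybe.map (λ p≡q → reflexive (≡.cong ⟦_⟧ p≡q)) (dec⇒maybe (p ℚₚ.≟ q))) public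
    using (Polynomial; solve; _:=_; _:+_; _:-_; _:*_; :-_; con)
  open MonoidSum +-commutativeMonoid public using (sum; sum-cong-≋)

  ι : ℕ → Carrier
  ι n = ⟦ + n / 1 ⟧

  `_ : ∀ {v} → ℕ → Polynomial v
  ` n = con (+ n / 1)

  ι-+ : ∀ m n → ι (m ℕ.+ n) ≈ ι m + ι n
  ι-+ m n = trans (reflexive (≡.cong ⟦_⟧ (/1-+ m n))) (+-homo (+ m / 1) (+ n / 1))

  ι-* : ∀ m n → ι (m ℕ.* n) ≈ ι m * ι n
  ι-* m n = trans (reflexive (≡.cong ⟦_⟧ (/1-* m n))) (*-homo (+ m / 1) (+ n / 1))

  ι-+2* : ∀ n t → ι (n ℕ.+ (t ℕ.+ t)) ≈ ι n + (ι t + ι t)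
  ι-+2* n t = trans (ι-+ n (t ℕ.+ t)) (+-congˡ (ι-+ t t))

  1/n*ιn : ∀ n .{{_ : ℕ.NonZero n}} → ⟦ + 1 / n ⟧ * ι n ≈ 1#
  1/n*ιn n = trans (sym (*-homo (+ 1 / n) (+ n / 1)))
    (trans (reflexive (≡.cong ⟦_⟧ (1/n*n n))) 1-homo)

  module Additive (m : ℕ) (f : ℕ⁺ → Carrier)
    (f-sum : (x : Vector ℕ⁺ (3 ℕ.+ m)) → f (sumOfSquares x) ≈ sum (λ i → f (x i) * f (x i)))
    where

    open GroupProperties +-group using () renaming (∙-cancelˡ to +-cancelˡ; ∙-cancelʳ to +-cancelʳ)
    open SetoidReasoning setoid

    -- The exchange relation and the interpolating quasi-polynomial `P`.

    G : ℕ⁺ → Carrier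
    G n = f n * f n

    triple : (a b c : ℕ⁺) → Vector ℕ⁺ (3 ℕ.+ m)
    triple a b c = a ∷ b ∷ c ∷ twos m

    _²+_²+_² : (a b c : ℕ⁺) → ℕ
    a ²+ b ²+ c ² = toℕ a ℕ.^ 2 ℕ.+ (toℕ b ℕ.^ 2 ℕ.+ toℕ c ℕ.^ 2)

    sumSq-triple : ∀ a b c → sumSq (triple a b c) ≡ (a ²+ b ²+ c ²) ℕ.+ sumSq (twos m)
    sumSq-triple a b c = lemma (toℕ a ℕ.^ 2) (toℕ b ℕ.^ 2) (toℕ c ℕ.^ 2) (sumSq (twos m))
      where
      lemma : ∀ x y z w → x ℕ.+ (y ℕ.+ (z ℕ.+ w)) ≡ x ℕ.+ (y ℕ.+ z) ℕ.+ w
      lemma = solve-∀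

    -- Positivity proofs are irrelevant, so the two arguments coincide once the underlying numbers
    -- do.
    f-cong-toℕ : ∀ n n′ → toℕ n ≡ toℕ n′ → f n ≈ f n′
    f-cong-toℕ (mkℕ⁺ n) (mkℕ⁺ .n) ≡.refl = refl

    exchange : ∀ a b c a′ b′ c′ → a ²+ b ²+ c ² ≡ a′ ²+ b′ ²+ c′ ² →
      G a + (G b + G c) ≈ G a′ + (G b′ + G c′)
    exchange a b c a′ b′ c′ eq = +-cancelʳ T _ _ (begin
      (G a + (G b + G c)) + T      ≈⟨ assoc₄ (G a) (G b) (G c) ⟨
      G a + (G b + (G c + T))      ≈⟨ f-sum (triple a b c) ⟨
      f (sumOfSquares (triple a b c))
        ≈⟨ f-cong-toℕ (sumOfSquares (triple a b c)) (sumOfSquares (triple a′ b′ c′))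
             (≡.trans (sumSq-triple a b c) (≡.trans (≡.cong (ℕ._+ sumSq (twos m)) eq)
               (≡.sym (sumSq-triple a′ b′ c′)))) ⟩
      f (sumOfSquares (triple a′ b′ c′)) ≈⟨ f-sum (triple a′ b′ c′) ⟩
      G a′ + (G b′ + (G c′ + T))   ≈⟨ assoc₄ (G a′) (G b′) (G c′) ⟩
      (G a′ + (G b′ + G c′)) + T   ∎)
      where
      T : Carrier
      T = sum (λ i → G (twos m i))
      assoc₄ : ∀ x y z → x + (y + (z + T)) ≈ (x + (y + z)) + T
      assoc₄ x y z = trans (+-congˡ (sym (+-assoc y z T))) (sym (+-assoc x (y + z) T))

    -- Chosen so that A n² + B + C [n odd] interpolates G at 1, 2 and 3.
    A B C : Carrier
    A = ⟦ + 1 / 8 ⟧ * (G (mkℕ⁺ 3) - G (mkℕ⁺ 1))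
    B = G (mkℕ⁺ 2) - ι 4 * A
    C = G (mkℕ⁺ 1) - A - B

    quad : Carrier → Carrier → Carrier
    quad x o = A * (x * x) + (B + C * o)

    quad-cong : ∀ {x y o} → x ≈ y → quad x o ≈ quad y o
    quad-cong x≈y = +-congʳ (*-congˡ (*-cong x≈y x≈y))

    P : ℕ⁺ → Carrier
    P n = quad (ι (toℕ n)) (ι (odd (toℕ n)))

    :quad : ∀ {v} (a b c x o : Polynomial v) → Polynomial v
    :quad a b c x o = a :* (x :* x) :+ (b :+ c :* o)

    -- `exchange` determines `G c` from the other five values. `P` obeys the same relation when both
    -- triples have equally many odd entries, as three squares with the same sum always do, by
    -- reduction modulo 4.
    deduce : ∀ a b c a′ b′ c′ → a ²+ b ²+ c ² ≡ a′ ²+ b′ ²+ c′ ² →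
      P a + (P b + P c) ≈ P a′ + (P b′ + P c′) →
      G a ≈ P a → G b ≈ P b → G a′ ≈ P a′ → G b′ ≈ P b′ → G c′ ≈ P c′ → G c ≈ P c
    deduce a b c a′ b′ c′ eq eqP Ga Gb Ga′ Gb′ Gc′ =
      +-cancelˡ (G b) _ _ (+-cancelˡ (G a) _ _ (begin
        G a + (G b + G c)        ≈⟨ exchange a b c a′ b′ c′ eq ⟩
        G a′ + (G b′ + G c′)     ≈⟨ +-cong Ga′ (+-cong Gb′ Gc′) ⟩
        P a′ + (P b′ + P c′)     ≈⟨ eqP ⟨
        P a + (P b + P c)        ≈⟨ +-cong Ga (+-congʳ Gb) ⟨
        G a + (G b + P c)        ∎))

    :P : ∀ {v} (a b c : Polynomial v) → ℕ → Polynomial v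
    :P a b c n = :quad a b c (` n) (` odd n)

    -- `G` at 1, ..., 10.

    [_] : ∀ n .{{_ : ℕ.NonZero n}} → ℕ⁺
    [ n ] = mkℕ⁺ n

    G1 : G [ 1 ] ≈ P [ 1 ]
    G1 = solve 3 (λ g a b → g := a :* (` 1 :* ` 1) :+ (b :+ (g :- a :- b) :* ` 1))
      refl (G [ 1 ]) A B

    G2 : G [ 2 ] ≈ P [ 2 ]
    G2 = solve 3 (λ g a c → g := a :* (` 2 :* ` 2) :+ (g :- ` 4 :* a :+ c :* ` 0))
      refl (G [ 2 ]) A C

    G3 : G [ 3 ] ≈ P [ 3 ]
    G3 = solve 3 (λ g h b → h := let a = con (+ 1 / 8) :* (h :- g) in
        a :* (` 3 :* ` 3) :+ (b :+ (g :- a :- b) :* ` 1))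
      refl (G [ 1 ]) (G [ 3 ]) B

    -- 5 precedes 4: 1 + 1 + 25 = 9 + 9 + 9 involves only 1 and 3 besides 5, whereas the coincidence
    -- used for 4 involves 5.
    G5 : G [ 5 ] ≈ P [ 5 ]
    G5 = deduce [ 1 ] [ 1 ] [ 5 ] [ 3 ] [ 3 ] [ 3 ] ≡.refl
      (solve 3 (λ a b c → let p = :P a b c in p 1 :+ (p 1 :+ p 5) := p 3 :+ (p 3 :+ p 3))
        refl A B C) G1 G1 G3 G3 G3

    -- In 1 + 16 + 16 = 4 + 4 + 25 the unknown occurs twice, so instead of applying `deduce` one
    -- solves for `G [ 4 ] + G [ 4 ]` and halves.
    G4 : G [ 4 ] ≈ P [ 4 ]
    G4 = begin
      G [ 4 ]
        ≈⟨ halve-≈ (G [ 1 ]) (G [ 4 ]) ⟩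
      con½ * ((G [ 1 ] + (G [ 4 ] + G [ 4 ])) - G [ 1 ])
        ≈⟨ *-congˡ (+-cong (exchange [ 1 ] [ 4 ] [ 4 ] [ 2 ] [ 2 ] [ 5 ] ≡.refl) (-‿cong G1)) ⟩
      con½ * ((G [ 2 ] + (G [ 2 ] + G [ 5 ])) - P [ 1 ])
        ≈⟨ *-congˡ (+-congʳ (+-cong G2 (+-cong G2 G5))) ⟩
      con½ * ((P [ 2 ] + (P [ 2 ] + P [ 5 ])) - P [ 1 ])
        ≈⟨ solve 3 (λ a b c → let p = :P a b c in
             con ½ :* ((p 2 :+ (p 2 :+ p 5)) :- p 1) := p 4) refl A B C ⟩
      P [ 4 ] ∎
      where
      con½ = ⟦ ½ ⟧
      halve-≈ : ∀ x y → y ≈ con½ * ((x + (y + y)) - x)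
      halve-≈ = solve 2 (λ x y → y := con ½ :* ((x :+ (y :+ y)) :- x)) refl

    G6 : G [ 6 ] ≈ P [ 6 ]
    G6 = deduce [ 1 ] [ 1 ] [ 6 ] [ 2 ] [ 3 ] [ 5 ] ≡.refl
      (solve 3 (λ a b c → let p = :P a b c in p 1 :+ (p 1 :+ p 6) := p 2 :+ (p 3 :+ p 5))
        refl A B C) G1 G1 G2 G3 G5

    G7 : G [ 7 ] ≈ P [ 7 ]
    G7 = deduce [ 1 ] [ 2 ] [ 7 ] [ 2 ] [ 5 ] [ 5 ] ≡.refl
      (solve 3 (λ a b c → let p = :P a b c in p 1 :+ (p 2 :+ p 7) := p 2 :+ (p 5 :+ p 5))
        refl A B C) G1 G2 G2 G5 G5

    G8 : G [ 8 ] ≈ P [ 8 ]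
    G8 = deduce [ 1 ] [ 1 ] [ 8 ] [ 4 ] [ 5 ] [ 5 ] ≡.refl
      (solve 3 (λ a b c → let p = :P a b c in p 1 :+ (p 1 :+ p 8) := p 4 :+ (p 5 :+ p 5))
        refl A B C) G1 G1 G4 G5 G5

    G9 : G [ 9 ] ≈ P [ 9 ]
    G9 = deduce [ 1 ] [ 2 ] [ 9 ] [ 1 ] [ 6 ] [ 7 ] ≡.refl
      (solve 3 (λ a b c → let p = :P a b c in p 1 :+ (p 2 :+ p 9) := p 1 :+ (p 6 :+ p 7))
        refl A B C) G1 G2 G1 G6 G7

    G10 : G [ 10 ] ≈ P [ 10 ]
    G10 = deduce [ 1 ] [ 1 ] [ 10 ] [ 2 ] [ 7 ] [ 7 ] ≡.refl
      (solve 3 (λ a b c → let p = :P a b c in p 1 :+ (p 1 :+ p 10) := p 2 :+ (p 7 :+ p 7))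
        refl A B C) G1 G1 G2 G7 G7

    -- Recurrences for `G`, and strong induction.

    G-odd : ∀ t → G [ 3 ℕ.+ t ] ≈ P [ 3 ℕ.+ t ] → G [ 7 ℕ.+ t ] ≈ P [ 7 ℕ.+ t ] →
      G [ 9 ℕ.+ (t ℕ.+ t) ] ≈ P [ 9 ℕ.+ (t ℕ.+ t) ] → G [ 11 ℕ.+ (t ℕ.+ t) ] ≈ P [ 11 ℕ.+ (t ℕ.+ t) ]
    G-odd t G3+t G7+t G9+2t =
      deduce [ 1 ] [ 3 ℕ.+ t ] [ 11 ℕ.+ (t ℕ.+ t) ] [ 1 ] [ 7 ℕ.+ t ] [ 9 ℕ.+ (t ℕ.+ t) ]
        (odd-family t) quads G1 G3+t G1 G7+t G9+2t
      where
      quads : P [ 1 ] + (P [ 3 ℕ.+ t ] + P [ 11 ℕ.+ (t ℕ.+ t) ]) ≈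
              P [ 1 ] + (P [ 7 ℕ.+ t ] + P [ 9 ℕ.+ (t ℕ.+ t) ])
      quads = +-congˡ (begin
        P [ 3 ℕ.+ t ] + P [ 11 ℕ.+ (t ℕ.+ t) ]
          ≈⟨ +-cong (quad-cong (ι-+ 3 t)) (quad-cong (ι-+2* 11 t)) ⟩
        quad (ι 3 + ι t) (ι (odd (1 ℕ.+ t))) + quad (ι 11 + (ι t + ι t)) (ι (odd (1 ℕ.+ (t ℕ.+ t))))
          -- `3 + t` and `7 + t` have equal parity, and so have `9 + (t + t)` and `11 + (t + t)`.
          -- Hence the parities can stay variables `o` and `o′`.
          ≈⟨ solve 6 (λ a b c x o o′ → let p = :quad a b c in
               p (` 3 :+ x) o :+ p (` 11 :+ (x :+ x)) o′ := p (` 7 :+ x) o :+ p (` 9 :+ (x :+ x)) o′)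
               refl A B C (ι t) (ι (odd (1 ℕ.+ t))) (ι (odd (1 ℕ.+ (t ℕ.+ t)))) ⟩
        quad (ι 7 + ι t) (ι (odd (1 ℕ.+ t))) + quad (ι 9 + (ι t + ι t)) (ι (odd (1 ℕ.+ (t ℕ.+ t))))
          ≈⟨ +-cong (quad-cong (ι-+ 7 t)) (quad-cong (ι-+2* 9 t)) ⟨
        P [ 7 ℕ.+ t ] + P [ 9 ℕ.+ (t ℕ.+ t) ] ∎)

    G-even : ∀ t → G [ 1 ℕ.+ t ] ≈ P [ 1 ℕ.+ t ] → G [ 9 ℕ.+ t ] ≈ P [ 9 ℕ.+ t ] →
      G [ 8 ℕ.+ (t ℕ.+ t) ] ≈ P [ 8 ℕ.+ (t ℕ.+ t) ] → G [ 12 ℕ.+ (t ℕ.+ t) ] ≈ P [ 12 ℕ.+ (t ℕ.+ t) ]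
    G-even t G1+t G9+t G8+2t =
      deduce [ 1 ] [ 1 ℕ.+ t ] [ 12 ℕ.+ (t ℕ.+ t) ] [ 1 ] [ 9 ℕ.+ t ] [ 8 ℕ.+ (t ℕ.+ t) ]
        (even-family t) quads G1 G1+t G1 G9+t G8+2t
      where
      quads : P [ 1 ] + (P [ 1 ℕ.+ t ] + P [ 12 ℕ.+ (t ℕ.+ t) ]) ≈
              P [ 1 ] + (P [ 9 ℕ.+ t ] + P [ 8 ℕ.+ (t ℕ.+ t) ])
      quads = +-congˡ (begin
        P [ 1 ℕ.+ t ] + P [ 12 ℕ.+ (t ℕ.+ t) ]
          ≈⟨ +-cong (quad-cong (ι-+ 1 t)) (quad-cong (ι-+2* 12 t)) ⟩
        quad (ι 1 + ι t) (ι (odd (1 ℕ.+ t))) + quad (ι 12 + (ι t + ι t)) (ι (odd (t ℕ.+ t)))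
          ≈⟨ solve 6 (λ a b c x o o′ → let p = :quad a b c in
               p (` 1 :+ x) o :+ p (` 12 :+ (x :+ x)) o′ := p (` 9 :+ x) o :+ p (` 8 :+ (x :+ x)) o′)
               refl A B C (ι t) (ι (odd (1 ℕ.+ t))) (ι (odd (t ℕ.+ t))) ⟩
        quad (ι 9 + ι t) (ι (odd (1 ℕ.+ t))) + quad (ι 8 + (ι t + ι t)) (ι (odd (t ℕ.+ t)))
          ≈⟨ +-cong (quad-cong (ι-+ 9 t)) (quad-cong (ι-+2* 8 t)) ⟨
        P [ 9 ℕ.+ t ] + P [ 8 ℕ.+ (t ℕ.+ t) ] ∎)

    -- The ten computed values suffice to start: at `t = 0` the two recurrences reach 11 and 12.
    G≈P[1+_] : ∀ n → G [ suc n ] ≈ P [ suc n ]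
    G≈P[1+_] = <-rec (λ n → G [ suc n ] ≈ P [ suc n ]) step
      where
      a+t<b+2t : ∀ {a b} t → a ℕ.< b → a ℕ.+ t ℕ.< b ℕ.+ (t ℕ.+ t)
      a+t<b+2t t a<b = ℕₚ.+-mono-<-≤ a<b (ℕₚ.m≤m+n t t)
      step : ∀ n → (∀ {j} → j ℕ.< n → G [ suc j ] ≈ P [ suc j ]) → G [ suc n ] ≈ P [ suc n ]
      step 0 _ = G1
      step 1 _ = G2
      step 2 _ = G3
      step 3 _ = G4
      step 4 _ = G5
      step 5 _ = G6
      step 6 _ = G7
      step 7 _ = G8
      step 8 _ = G9
      step 9 _ = G10
      -- The index is one less than the value, so the target is `G` at `11 + r`. An even `r` is
      -- reached by `G-odd`, an odd `r` by `G-even`.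
      step (suc (suc (suc (suc (suc (suc (suc (suc (suc (suc r)))))))))) rec with halve r
      ... | t , inj₁ ≡.refl = G-odd t
        (rec (a+t<b+2t t (ℕₚ.m≤m+n 3 7))) (rec (a+t<b+2t t (ℕₚ.m≤m+n 7 3)))
        (rec (ℕₚ.+-monoˡ-< (t ℕ.+ t) (ℕₚ.m≤m+n 9 1)))
      ... | t , inj₂ ≡.refl = G-even t
        (rec (a+t<b+2t t (ℕₚ.m≤m+n 1 10))) (rec (a+t<b+2t t (ℕₚ.m≤m+n 9 2)))
        (rec (ℕₚ.+-monoˡ-< (t ℕ.+ t) (ℕₚ.m≤m+n 8 3)))

    G≈P : ∀ n → G n ≈ P n
    G≈P (mkℕ⁺ (suc n)) = G≈P[1+ n ]

    -- Evaluating `f` at sums of squares in two ways.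

    q k K : Carrier
    q = ι m
    k = ι 3 + q
    -- `K` is the constant term in the value A N + K + j C of `f` at a sum N of k squares, j of them
    -- odd. Writing `k` as `ι 3 + q` keeps everything polynomial in `q`.
    K = k * B

    f-triple : Carrier → Carrier → Carrier → Carrier
    f-triple x y z = x + (y + (z + q * P 2⁺))

    ι-twos : ∀ n → ι (sumSq (twos n)) ≈ ι 4 * ι n
    ι-twos zero    = solve 0 (` 0 := ` 4 :* ` 0) refl
    ι-twos (suc n) = begin
      ι (4 ℕ.+ sumSq (twos n))      ≈⟨ ι-+ 4 (sumSq (twos n)) ⟩
      ι 4 + ι (sumSq (twos n))      ≈⟨ +-congˡ (ι-twos n) ⟩
      ι 4 + ι 4 * ι n               ≈⟨ solve 1 (λ x → ` 4 :+ ` 4 :* x := ` 4 :* (` 1 :+ x)) refl (ι n) ⟩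
      ι 4 * (ι 1 + ι n)             ≈⟨ *-congˡ (ι-+ 1 n) ⟨
      ι 4 * ι (suc n)               ∎

    sum-const : ∀ n {x} → sum {n} (λ _ → x) ≈ ι n * x
    sum-const zero    {x} = trans (sym 0-homo) (solve 1 (λ x → ` 0 := ` 0 :* x) refl x)
    sum-const (suc n) {x} = begin
      x + sum {n} (λ _ → x)   ≈⟨ +-congˡ (sum-const n) ⟩
      x + ι n * x             ≈⟨ solve 2 (λ x y → x :+ y :* x := (` 1 :+ y) :* x) refl x (ι n) ⟩
      (ι 1 + ι n) * x         ≈⟨ *-congʳ (ι-+ 1 n) ⟨
      ι (suc n) * x           ∎

    -- At the sum s of the squares, `f-sum` gives `f s` as a sum of values of `P`, while `G≈P` gives
    -- its square as `P s`; comparing them constrains `A`, `B` and `C`. The padding by twos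
    -- contributes `ι 4 * q`.
    f-square-sum : ∀ a b c N {o} → sumSq (triple a b c) ≡ N ℕ.+ sumSq (twos m) →
      odd (N ℕ.+ sumSq (twos m)) ≡ o →
      f-triple (P a) (P b) (P c) * f-triple (P a) (P b) (P c) - quad (ι N + ι 4 * q) (ι o) ≈ ι 0
    f-square-sum a b c N {o} sum≡ odd≡ = begin
      F * F - quad (ι N + ι 4 * q) (ι o)
        ≈⟨ +-cong (*-cong f≈F f≈F) (-‿cong (quad-cong (trans (ι-+ N (sumSq (twos m))) (+-congˡ (ι-twos m))))) ⟨
      G s - quad (ι (N ℕ.+ sumSq (twos m))) (ι o)
        ≈⟨ +-congˡ (-‿cong (reflexive (≡.cong₂ (λ x y → quad (ι x) (ι y))
             (≡.sym sum≡) (≡.trans (≡.sym odd≡) (≡.cong odd (≡.sym sum≡)))))) ⟩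
      G s - P s
        ≈⟨ +-congʳ (G≈P s) ⟩
      P s - P s
        ≈⟨ solve 1 (λ x → x :- x := ` 0) refl (P s) ⟩
      ι 0 ∎
      where
      s : ℕ⁺
      s = sumOfSquares (triple a b c)
      F : Carrier
      F = f-triple (P a) (P b) (P c)
      f≈F : f s ≈ F
      f≈F = trans (f-sum (triple a b c)) (+-cong (G≈P a) (+-cong (G≈P b) (+-cong (G≈P c)
        (trans (sum-const m) (*-congˡ (G≈P 2⁺))))))

    -- The left-hand side of f-square-sum at (x, y, z), as a polynomial in A, B, C, q.
    :discrepancy : ∀ {v} (a b c q : Polynomial v) (x y z N o : ℕ) → Polynomial v
    :discrepancy a b c q x y z N o = F :* F :- :quad a b c (` N :+ ` 4 :* q) (` o)
      where
      p : ℕ → Polynomial _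
      p = :P a b c
      F : Polynomial _
      F = p x :+ (p y :+ (p z :+ q :* p 2))

    -- Relations between `A`, `B`, `C` and `K`.

    infixr 7 _·₀_
    infixr 6 _+₀_

    -- Each relation below is an ideal membership: `solve` writes it as a combination of quantities
    -- known to vanish, and `_·₀_` and `_+₀_` then annihilate the combination.
    _·₀_ : ∀ u {x} → x ≈ ι 0 → u * x ≈ ι 0
    u ·₀ x≈0 = trans (*-congˡ x≈0) (solve 1 (λ u → u :* ` 0 := ` 0) refl u)

    _+₀_ : ∀ {x y} → x ≈ ι 0 → y ≈ ι 0 → x + y ≈ ι 0
    x≈0 +₀ y≈0 = trans (+-cong x≈0 y≈0) (solve 0 (` 0 :+ ` 0 := ` 0) refl)

    :k :K : ∀ {v} (b q : Polynomial v) → Polynomial v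
    :k b q = ` 3 :+ q
    :K b q = :k b q :* b

    -- The triples have no odd entry in `D₀`, `D₁`, `D₂`, two in `D₃`, `D₄`, and one in `D₅`.
    D₀ = f-square-sum [ 2 ] [ 2 ] [ 2 ] 12 ≡.refl (odd-twos m)
    D₁ = f-square-sum [ 2 ] [ 2 ] [ 4 ] 24 ≡.refl (odd-twos m)
    D₂ = f-square-sum [ 2 ] [ 4 ] [ 4 ] 36 ≡.refl (odd-twos m)
    D₃ = f-square-sum [ 1 ] [ 1 ] [ 2 ] 6 ≡.refl (odd-twos m)
    D₄ = f-square-sum [ 1 ] [ 1 ] [ 4 ] 18 ≡.refl (odd-twos m)
    D₅ = f-square-sum [ 1 ] [ 2 ] [ 2 ] 9 ≡.refl (odd-suc-twos m)

    -- For even N the discrepancy is (A² − A) N² + 2 A K N + K² − B plus terms in C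
    -- that vanish when all entries are even.  At N = 12 + 4q, 24 + 4q and 36 + 4q its
    -- second difference is 2 · 12² (A² − A).
    A²-A≈0 : A * A - A ≈ ι 0
    A²-A≈0 = trans
      (solve 4 (λ a b c q → a :* a :- a :=
          con (+ 1 / 288) :* :discrepancy a b c q 2 2 2 12 0
          :+ (con (ℤ.- + 1 / 144) :* :discrepancy a b c q 2 2 4 24 0
          :+ con (+ 1 / 288) :* :discrepancy a b c q 2 4 4 36 0)) refl A B C q)
      (_ ·₀ D₀ +₀ _ ·₀ D₁ +₀ _ ·₀ D₂)

    -- The first difference of the same expression, from 12 + 4q to 24 + 4q, is 24 A K plus a
    -- multiple of A² - A.
    A*K≈0 : A * K ≈ ι 0
    A*K≈0 = trans
      (solve 4 (λ a b c q → let n₀ = ` 12 :+ ` 4 :* q; n₁ = ` 24 :+ ` 4 :* q in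
          a :* :K b q :=
          con (+ 1 / 24) :* :discrepancy a b c q 2 2 4 24 0
          :+ (con (ℤ.- + 1 / 24) :* :discrepancy a b c q 2 2 2 12 0
          :+ con (ℤ.- + 1 / 24) :* (n₁ :* n₁ :- n₀ :* n₀) :* (a :* a :- a))) refl A B C q)
      (_ ·₀ D₁ +₀ _ ·₀ D₀ +₀ _ ·₀ A²-A≈0)

    -- This is what is left of `D₀` after removing the multiples of A² - A and A K.
    K²-B≈0 : K * K - B ≈ ι 0
    K²-B≈0 = trans
      (solve 4 (λ a b c q → let n = ` 12 :+ ` 4 :* q in
          :K b q :* :K b q :- b :=
          ` 1 :* :discrepancy a b c q 2 2 2 12 0
          :+ ((` 0 :- n :* n) :* (a :* a :- a)
          :+ (` 0 :- ` 2 :* n) :* (a :* :K b q))) refl A B C q)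
      (_ ·₀ D₀ +₀ _ ·₀ A²-A≈0 +₀ _ ·₀ A*K≈0)

    -- Two odd entries add 4 A C N + 4 (K C + C²) to the discrepancy; the difference between 6 + 4q
    -- and 18 + 4q isolates 48 A C.
    A*C≈0 : A * C ≈ ι 0
    A*C≈0 = trans
      (solve 4 (λ a b c q → let n₀ = ` 6 :+ ` 4 :* q; n₁ = ` 18 :+ ` 4 :* q in
          a :* c :=
          con (+ 1 / 48) :* :discrepancy a b c q 1 1 4 18 0
          :+ (con (ℤ.- + 1 / 48) :* :discrepancy a b c q 1 1 2 6 0
          :+ (con (ℤ.- + 1 / 48) :* (n₁ :* n₁ :- n₀ :* n₀) :* (a :* a :- a)
          :+ con (ℤ.- + 1 / 2) :* (a :* :K b q)))) refl A B C q)
      (_ ·₀ D₄ +₀ _ ·₀ D₃ +₀ _ ·₀ A²-A≈0 +₀ _ ·₀ A*K≈0)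

    -- The remaining part of `D₃` is 4 (K C + C²).
    K*C+C²≈0 : K * C + C * C ≈ ι 0
    K*C+C²≈0 = trans
      (solve 4 (λ a b c q → let n = ` 6 :+ ` 4 :* q in
          :K b q :* c :+ c :* c :=
          con (+ 1 / 4) :* :discrepancy a b c q 1 1 2 6 0
          :+ (con (ℤ.- + 1 / 4) :* (n :* n) :* (a :* a :- a)
          :+ (con (ℤ.- + 1 / 2) :* n :* (a :* :K b q)
          :+ ((` 0 :- n) :* (a :* c)
          :+ con (ℤ.- + 1 / 4) :* (:K b q :* :K b q :- b))))) refl A B C q)
      (_ ·₀ D₃ +₀ _ ·₀ A²-A≈0 +₀ _ ·₀ A*K≈0 +₀ _ ·₀ A*C≈0 +₀ _ ·₀ K²-B≈0)

    -- One odd entry makes N odd and adds 2 A C N + 2 K C + C² - C; subtracting K C + C² and the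
    -- multiple of A C leaves K C - C.
    K*C-C≈0 : K * C - C ≈ ι 0
    K*C-C≈0 = trans
      (solve 4 (λ a b c q → let n = ` 9 :+ ` 4 :* q in
          :K b q :* c :- c :=
          ` 1 :* :discrepancy a b c q 1 2 2 9 1
          :+ ((` 0 :- n :* n) :* (a :* a :- a)
          :+ ((` 0 :- ` 2 :* n) :* (a :* :K b q)
          :+ ((` 0 :- ` 2 :* n) :* (a :* c)
          :+ ((` 0 :- ` 1) :* (:K b q :* :K b q :- b)
          :+ (` 0 :- ` 1) :* (:K b q :* c :+ c :* c)))))) refl A B C q)
      (_ ·₀ D₅ +₀ _ ·₀ A²-A≈0 +₀ _ ·₀ A*K≈0 +₀ _ ·₀ A*C≈0 +₀ _ ·₀ K²-B≈0 +₀ _ ·₀ K*C+C²≈0)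

    -- C = K C, hence C = K² C = B C, and therefore k C = k B C = K C = C.
    C≈0 : C ≈ ι 0
    C≈0 = begin
      C                                       ≈⟨ *-identityˡ C ⟨
      -- `ι (2 + m)` is k - 1, which is invertible and annihilates `C` because k C = C.
      1# * C                                  ≈⟨ *-congʳ (1/n*ιn (2 ℕ.+ m)) ⟨
      ⟦ + 1 / (2 ℕ.+ m) ⟧ * ι (2 ℕ.+ m) * C   ≈⟨ *-assoc _ _ _ ⟩
      ⟦ + 1 / (2 ℕ.+ m) ⟧ * (ι (2 ℕ.+ m) * C) ≈⟨ *-congˡ (*-congʳ (ι-+ 2 m)) ⟩
      ⟦ + 1 / (2 ℕ.+ m) ⟧ * ((ι 2 + q) * C)   ≈⟨ _ ·₀ trans
        (solve 3 (λ b c q → (` 2 :+ q) :* c :=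
          (` 1 :- :k b q :* (:K b q :+ ` 1)) :* (:K b q :* c :- c)
          :+ :k b q :* c :* (:K b q :* :K b q :- b)) refl B C q)
        (_ ·₀ K*C-C≈0 +₀ _ ·₀ K²-B≈0) ⟩
      ι 0                                     ∎

    G-quadratic : ∀ n → G n ≈ A * (ι (toℕ n) * ι (toℕ n)) + B
    G-quadratic n = begin
      G n                                     ≈⟨ G≈P n ⟩
      A * (x * x) + (B + C * o)               ≈⟨ +-congˡ (+-congˡ (*-congʳ C≈0)) ⟩
      A * (x * x) + (B + ι 0 * o)
        ≈⟨ solve 4 (λ a b x o → a :* (x :* x) :+ (b :+ ` 0 :* o) := a :* (x :* x) :+ b) refl A B x o ⟩
      A * (x * x) + B                         ∎
      where
      x o : Carrier
      x = ι (toℕ n)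
      o = ι (odd (toℕ n))

    sum-ι² : ∀ {n} (x : Vector ℕ⁺ n) → sum (λ i → ι (toℕ (x i)) * ι (toℕ (x i))) ≈ ι (sumSq x)
    sum-ι² {zero}  x = sym 0-homo
    sum-ι² {suc n} x = begin
      ι a * ι a + sum (λ i → ι (toℕ (x (suc i))) * ι (toℕ (x (suc i))))
        ≈⟨ +-cong (sym (ι-^2 a)) (sum-ι² (λ i → x (suc i))) ⟩
      ι (a ℕ.^ 2) + ι (sumSq (λ i → x (suc i)))
        ≈⟨ ι-+ (a ℕ.^ 2) (sumSq (λ i → x (suc i))) ⟨
      ι (sumSq x) ∎
      where
      a : ℕ
      a = toℕ (x zero)
      ι-^2 : ∀ n → ι (n ℕ.^ 2) ≈ ι n * ι n
      ι-^2 n = trans (ι-* n (n ℕ.* 1)) (*-congˡ (reflexive (≡.cong ι (ℕₚ.*-identityʳ n))))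

    -- The sign alternative follows from the value of `G n` alone, so it is stated for every `n`.
    IsClassifiedBy : (ℕ⁺ → Carrier) → Set ℓ
    IsClassifiedBy h = ∀ n →
      (IsSumOfSquares (3 ℕ.+ m) n → f n ≈ h n) × (f n ≈ h n ⊎ f n ≈ - h n)

    -- The three cases, from the idempotents `A` and `k * K`.

    module _ (idempotent : ∀ z → z * z ≈ z → z ≈ 0# ⊎ z ≈ 1#)
             (reduced : ∀ z → z * z ≈ 0# → z ≈ 0#)
      where

      -- If u is an inverse of v, then (u z + 1) / 2 is idempotent.
      square-roots : ∀ {u v z} → u * v ≈ 1# → z * z ≈ v * v → z ≈ v ⊎ z ≈ - v
      square-roots {u} {v} {z} uv≈1 z²≈v² = roots (idempotent e e²≈e)
        where
        e : Carrier
        e = ⟦ ½ ⟧ * (u * z + ι 1)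
        z≈ : z ≈ v * (ι 2 * e - ι 1)
        z≈ = begin
          z                     ≈⟨ *-identityˡ z ⟨
          1# * z                ≈⟨ *-congʳ uv≈1 ⟨
          u * v * z
            ≈⟨ solve 3 (λ u v z → u :* v :* z := v :* (` 2 :* (con ½ :* (u :* z :+ ` 1)) :- ` 1))
                 refl u v z ⟩
          v * (ι 2 * e - ι 1)   ∎
        u²z²≈1 : u * u * (z * z) ≈ ι 1
        u²z²≈1 = begin
          u * u * (z * z)       ≈⟨ *-congˡ z²≈v² ⟩
          u * u * (v * v)       ≈⟨ solve 2 (λ u v → u :* u :* (v :* v) := u :* v :* (u :* v)) refl u v ⟩
          u * v * (u * v)       ≈⟨ *-cong uv≈1 uv≈1 ⟩
          1# * 1#               ≈⟨ *-identityˡ 1# ⟩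
          1#                    ≈⟨ 1-homo ⟨
          ι 1                   ∎
        e²≈e : e * e ≈ e
        e²≈e = begin
          e * e
            ≈⟨ solve 2 (λ u z → let e = con ½ :* (u :* z :+ ` 1) in
                 e :* e := e :+ con (+ 1 / 4) :* (u :* u :* (z :* z) :- ` 1)) refl u z ⟩
          e + ⟦ + 1 / 4 ⟧ * (u * u * (z * z) - ι 1)
            ≈⟨ +-congˡ (*-congˡ (+-congʳ u²z²≈1)) ⟩
          e + ⟦ + 1 / 4 ⟧ * (ι 1 - ι 1)
            ≈⟨ solve 1 (λ e → e :+ con (+ 1 / 4) :* (` 1 :- ` 1) := e) refl e ⟩
          e ∎
        roots : e ≈ 0# ⊎ e ≈ 1# → z ≈ v ⊎ z ≈ - v
        roots (inj₁ e≈0) = inj₂ (begin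
          z                       ≈⟨ z≈ ⟩
          v * (ι 2 * e - ι 1)     ≈⟨ *-congˡ (+-congʳ (*-congˡ (trans e≈0 (sym 0-homo)))) ⟩
          v * (ι 2 * ι 0 - ι 1)   ≈⟨ solve 1 (λ v → v :* (` 2 :* ` 0 :- ` 1) := :- v) refl v ⟩
          - v                     ∎)
        roots (inj₂ e≈1) = inj₁ (begin
          z                       ≈⟨ z≈ ⟩
          v * (ι 2 * e - ι 1)     ≈⟨ *-congˡ (+-congʳ (*-congˡ (trans e≈1 (sym 1-homo)))) ⟩
          v * (ι 2 * ι 1 - ι 1)   ≈⟨ solve 1 (λ v → v :* (` 2 :* ` 1 :- ` 1) := v) refl v ⟩
          v                       ∎)

      -- A K = 0 forces K = 0, then B = K² = 0, so `G n` is n². Summing this gives `f` at sums of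
      -- squares; elsewhere `square-roots` applies since n is invertible.
      identity-case : A ≈ 1# → IsClassifiedBy (λ n → ι (toℕ n))
      identity-case A≈1 n⁺@(mkℕ⁺ n) = value , square-roots (1/n*ιn n) (G≈ n⁺)
        where
        A≈ι1 : A ≈ ι 1
        A≈ι1 = trans A≈1 (sym 1-homo)
        K≈0 : K ≈ ι 0
        K≈0 = begin
          K         ≈⟨ solve 1 (λ x → x := ` 1 :* x) refl K ⟩
          ι 1 * K   ≈⟨ *-congʳ A≈ι1 ⟨
          A * K     ≈⟨ A*K≈0 ⟩
          ι 0       ∎
        B≈0 : B ≈ ι 0
        B≈0 = trans
          (solve 2 (λ b x → b := x :* x :+ con (ℤ.- + 1 / 1) :* (x :* x :- b)) refl B K)
          (_ ·₀ K≈0 +₀ _ ·₀ K²-B≈0)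
        G≈ : ∀ n → G n ≈ ι (toℕ n) * ι (toℕ n)
        G≈ n = begin
          G n                                 ≈⟨ G-quadratic n ⟩
          A * (ι (toℕ n) * ι (toℕ n)) + B     ≈⟨ +-cong (*-congʳ A≈ι1) B≈0 ⟩
          ι 1 * (ι (toℕ n) * ι (toℕ n)) + ι 0
            ≈⟨ solve 1 (λ x → ` 1 :* (x :* x) :+ ` 0 := x :* x) refl (ι (toℕ n)) ⟩
          ι (toℕ n) * ι (toℕ n)               ∎
        value : IsSumOfSquares (3 ℕ.+ m) n⁺ → f n⁺ ≈ ι n
        value (x , ≡.refl) = trans (f-sum x) (trans (sum-cong-≋ (λ i → G≈ (x i))) (sum-ι² x))

      module _ (A≈0 : A ≈ 0#) where

        G≈B : ∀ n → G n ≈ B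
        G≈B n = begin
          G n                                 ≈⟨ G-quadratic n ⟩
          A * (ι (toℕ n) * ι (toℕ n)) + B     ≈⟨ +-congʳ (*-congʳ A≈0) ⟩
          0# * (ι (toℕ n) * ι (toℕ n)) + B    ≈⟨ +-congʳ (zeroˡ _) ⟩
          0# + B                              ≈⟨ +-identityˡ B ⟩
          B                                   ∎

        -- (k K)² = k² K² = k² B = k K.
        k*K-idempotent : (k * K) * (k * K) ≈ k * K
        k*K-idempotent = begin
          (k * K) * (k * K)
            ≈⟨ solve 2 (λ b k → let x = k :* b in
                 (k :* x) :* (k :* x) := k :* x :+ k :* k :* (x :* x :- b)) refl B k ⟩
          k * K + k * k * (K * K - B)   ≈⟨ +-congˡ (_ ·₀ K²-B≈0) ⟩
          k * K + ι 0                   ≈⟨ solve 1 (λ x → x :+ ` 0 := x) refl (k * K) ⟩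
          k * K                         ∎

        -- B = K² = B (k K) = 0, so every `f n` squares to zero.
        zero-case : k * K ≈ 0# → ∀ n → f n ≈ 0#
        zero-case kK≈0 n = reduced (f n) (begin
          G n         ≈⟨ G≈B n ⟩
          B
            ≈⟨ solve 2 (λ b k → let x = k :* b in
                 b := b :* (k :* x) :+ con (ℤ.- + 1 / 1) :* (x :* x :- b)) refl B k ⟩
          B * (k * K) + ⟦ ℤ.- + 1 / 1 ⟧ * (K * K - B)
            ≈⟨ _ ·₀ trans kK≈0 (sym 0-homo) +₀ _ ·₀ K²-B≈0 ⟩
          ι 0         ≈⟨ 0-homo ⟩
          0#          ∎)

        -- Here K = 1/k and `G n` is B = K² = 1/k². At a sum of k squares, `f` is k B = K = 1/k.
        reciprocal-case : k * K ≈ 1# → IsClassifiedBy (λ _ → ⟦ + 1 / (3 ℕ.+ m) ⟧)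
        reciprocal-case kK≈1 n = value , square-roots (trans (*-comm _ _) (1/n*ιn (3 ℕ.+ m))) G≈u²
          where
          u : Carrier
          u = ⟦ + 1 / (3 ℕ.+ m) ⟧
          K≈u : K ≈ u
          K≈u = begin
            K                     ≈⟨ *-identityˡ K ⟨
            1# * K                ≈⟨ *-congʳ (1/n*ιn (3 ℕ.+ m)) ⟨
            u * ι (3 ℕ.+ m) * K   ≈⟨ *-assoc _ _ _ ⟩
            u * (ι (3 ℕ.+ m) * K) ≈⟨ *-congˡ (*-congʳ (ι-+ 3 m)) ⟩
            u * (k * K)           ≈⟨ *-congˡ kK≈1 ⟩
            u * 1#                ≈⟨ *-identityʳ u ⟩
            u                     ∎
          G≈u² : G n ≈ u * u
          G≈u² = begin
            G n                   ≈⟨ G≈B n ⟩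
            B                     ≈⟨ solve 2 (λ b x → b := x :* x :- (x :* x :- b)) refl B K ⟩
            K * K - (K * K - B)   ≈⟨ +-congˡ (-‿cong K²-B≈0) ⟩
            K * K - ι 0           ≈⟨ solve 1 (λ x → x :* x :- ` 0 := x :* x) refl K ⟩
            K * K                 ≈⟨ *-cong K≈u K≈u ⟩
            u * u                 ∎
          value : IsSumOfSquares (3 ℕ.+ m) n → f n ≈ u
          value (x , ≡.refl) = begin
            f n                     ≈⟨ f-sum x ⟩
            sum (λ i → G (x i))     ≈⟨ sum-cong-≋ (λ i → G≈B (x i)) ⟩
            sum (λ (i : Fin (3 ℕ.+ m)) → B)  ≈⟨ sum-const (3 ℕ.+ m) ⟩
            ι (3 ℕ.+ m) * B         ≈⟨ *-congʳ (ι-+ 3 m) ⟩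
            K                       ≈⟨ K≈u ⟩
            u                       ∎

      A²≈A : A * A ≈ A
      A²≈A = begin
        A * A             ≈⟨ solve 1 (λ a → a :* a := a :* a :- a :+ a) refl A ⟩
        A * A - A + A     ≈⟨ +-congʳ A²-A≈0 ⟩
        ι 0 + A           ≈⟨ solve 1 (λ a → ` 0 :+ a := a) refl A ⟩
        A                 ∎

      classification : (∀ n → f n ≈ 0#)
        ⊎ IsClassifiedBy (λ n → ι (toℕ n))
        ⊎ IsClassifiedBy (λ _ → ⟦ + 1 / (3 ℕ.+ m) ⟧)
      classification = [ (λ A≈0 → Sum.map (zero-case A≈0) (λ kK≈1 → inj₂ (reciprocal-case A≈0 kK≈1))
                           (idempotent (k * K) (k*K-idempotent A≈0)))
                       , (λ A≈1 → inj₂ (inj₁ (identity-case A≈1))) ]′ (idempotent A A²≈A)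

-- Null sequences and the ring ℂ

open Defs using (_≈_; _+_; _*_; -_; _²)

-- `x ≈ᵣ y` unfolds to `Null` of the termwise difference, so equality in ℝ is handled through null
-- sequences.
Null : (ℕ → ℚ) → Set
Null u = ∀ ε → 0ℚ ℚ.< ε → ∃[ N ] (∀ n → N ℕ.≤ n → ∣ u n ∣ ℚ.< ε)

null-ext : ∀ {u v} → (∀ n → u n ≡ v n) → Null v → Null u
null-ext u≡v v→0 ε 0<ε with v→0 ε 0<ε
... | N , small = N , λ n N≤n →
  ≡.subst (λ q → ∣ q ∣ ℚ.< ε) (≡.sym (u≡v n)) (small n N≤n)

null-dominated : ∀ {u v} M → (∀ n → M ℕ.≤ n → ∣ u n ∣ ℚ.≤ ∣ v n ∣) → Null v → Null u
null-dominated M u≤v v→0 ε 0<ε with v→0 ε 0<ε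
... | N , small = M ℕ.⊔ N , λ n ≤n →
  ℚₚ.≤-<-trans (u≤v n (ℕₚ.m⊔n≤o⇒m≤o M N ≤n)) (small n (ℕₚ.m⊔n≤o⇒n≤o M N ≤n))

null-0 : Null (λ _ → 0ℚ)
null-0 ε 0<ε = 0 , λ _ _ → 0<ε

null-neg : ∀ {u} → Null u → Null (λ n → ℚ.- u n)
null-neg {u} = null-dominated 0 (λ n _ → ℚₚ.≤-reflexive (ℚₚ.∣-p∣≡∣p∣ (u n)))

null-+ : ∀ {u v} → Null u → Null v → Null (λ n → u n ℚ.+ v n)
null-+ {u} {v} u→0 v→0 ε 0<ε with u→0 (½ ℚ.* ε) (½*-pos 0<ε) | v→0 (½ ℚ.* ε) (½*-pos 0<ε)
... | M , u< | N , v< = M ℕ.⊔ N , λ n ≤n →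
  ∣+∣<ε ε (u n) (v n) (u< n (ℕₚ.m⊔n≤o⇒m≤o M N ≤n)) (v< n (ℕₚ.m⊔n≤o⇒n≤o M N ≤n))

-- A Cauchy sequence is eventually bounded.
real*null : ∀ x {v} → Null v → Null (λ n → seq x n ℚ.* v n)
real*null x {v} v→0 ε 0<ε with eventuallyBounded (seq x) (cauchy x)
... | B , 0<B , M , x≤B with scale B 0<B ε 0<ε
... | δ , 0<δ , x*v<ε with v→0 δ 0<δ
... | N , v<δ = M ℕ.⊔ N , λ n ≤n →
  x*v<ε (seq x n) (v n) (x≤B n (ℕₚ.m⊔n≤o⇒m≤o M N ≤n)) (v<δ n (ℕₚ.m⊔n≤o⇒n≤o M N ≤n))

-- The hypothesis is used at ε²: a term with ∣u∣ ≥ ε would have square at least ε².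
null-√ : ∀ {u} → Null (λ n → u n ℚ.* u n) → Null u
null-√ {u} u²→0 ε 0<ε with u²→0 (ε ℚ.* ε) (≡.subst (ℚ._< ε ℚ.* ε) (ℚₚ.*-zeroʳ ε)
                              (ℚₚ.*-monoʳ-<-pos ε {{ℚ.positive 0<ε}} 0<ε))
... | N , u²<ε² = N , λ n N≤n → ℚₚ.≰⇒> λ ε≤∣u∣ →
  ℚₚ.<-irrefl ≡.refl (ℚₚ.<-≤-trans (u²<ε² n N≤n) (begin
  ε ℚ.* ε              ≤⟨ ℚₚ.*-monoˡ-≤-nonNeg ε {{ℚₚ.pos⇒nonNeg ε {{ℚ.positive 0<ε}}}} ε≤∣u∣ ⟩
  ε ℚ.* ∣ u n ∣        ≤⟨ ℚₚ.*-monoʳ-≤-nonNeg ∣ u n ∣ {{ℚₚ.∣-∣-nonNeg (u n)}} ε≤∣u∣ ⟩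
  ∣ u n ∣ ℚ.* ∣ u n ∣  ≡⟨ ℚₚ.∣p*q∣≡∣p∣*∣q∣ (u n) (u n) ⟨
  ∣ u n ℚ.* u n ∣      ∎))
  where open ℚₚ.≤-Reasoning

pointwise : ∀ x y → (∀ n → seq x n ≡ seq y n) → x ≈ᵣ y
pointwise x y x≡y = null-ext
  (λ n → ≡.trans (≡.cong (ℚ._- seq y n) (x≡y n)) (ℚₚ.+-inverseʳ (seq y n))) null-0

≈ᵣ-refl : ∀ {x} → x ≈ᵣ x
≈ᵣ-refl {x} = pointwise x x (λ _ → ≡.refl)

≈ᵣ-sym : ∀ {x y} → x ≈ᵣ y → y ≈ᵣ x
≈ᵣ-sym {x} {y} x≈y = null-ext (λ n → flip (seq x n) (seq y n)) (null-neg x≈y)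
  where
  open +-*-Solver
  flip : ∀ a b → b ℚ.- a ≡ ℚ.- (a ℚ.- b)
  flip = solve 2 (λ a b → b :- a := :- (a :- b)) ≡.refl

≈ᵣ-trans : ∀ {x y z} → x ≈ᵣ y → y ≈ᵣ z → x ≈ᵣ z
≈ᵣ-trans {x} {y} {z} x≈y y≈z =
  null-ext (λ n → telescope (seq x n) (seq y n) (seq z n)) (null-+ x≈y y≈z)
  where
  open +-*-Solver
  telescope : ∀ a b c → a ℚ.- c ≡ (a ℚ.- b) ℚ.+ (b ℚ.- c)
  telescope = solve 3 (λ a b c → a :- c := (a :- b) :+ (b :- c)) ≡.refl

+ᵣ-cong : ∀ {x x′ y y′} → x ≈ᵣ x′ → y ≈ᵣ y′ → x +ᵣ y ≈ᵣ x′ +ᵣ y′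
+ᵣ-cong {x} {x′} {y} {y′} x≈x′ y≈y′ = null-ext
  (λ n → +-difference (seq x n) (seq y n) (seq x′ n) (seq y′ n)) (null-+ x≈x′ y≈y′)

*ᵣ-cong : ∀ {x x′ y y′} → x ≈ᵣ x′ → y ≈ᵣ y′ → x *ᵣ y ≈ᵣ x′ *ᵣ y′
*ᵣ-cong {x} {x′} {y} {y′} x≈x′ y≈y′ = null-ext
  (λ n → *-difference (seq x n) (seq y n) (seq x′ n) (seq y′ n))
  (null-+ (real*null x y≈y′) (real*null y′ x≈x′))

-ᵣ-cong : ∀ {x y} → x ≈ᵣ y → -ᵣ x ≈ᵣ -ᵣ y
-ᵣ-cong {x} {y} x≈y = null-ext (λ n → neg-difference (seq x n) (seq y n)) (null-neg x≈y)

termwise : ∀ z w → (∀ n → seq (re z) n ≡ seq (re w) n) → (∀ n → seq (im z) n ≡ seq (im w) n) →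
  z ≈ w
termwise z w re≡ im≡ = pointwise (re z) (re w) re≡ , pointwise (im z) (im w) im≡

-- Since the operations of ℂ are termwise, its ring laws are identities of
-- rational polynomials in the terms of the real and imaginary parts.
module _ where
  open +-*-Solver

  private
    Re Im : ∀ {n} → (_ _ _ _ : Polynomial n) → Polynomial n
    Re a b c d = a :* c :- b :* d
    Im a b c d = a :* d :+ b :* c

  *-assocℂ : ∀ z w v → (z * w) * v ≈ z * (w * v)
  *-assocℂ z w v = termwise ((z * w) * v) (z * (w * v))
    (λ n → solve 6 (λ a b c d e f →
        Re (Re a b c d) (Im a b c d) e f := Re a b (Re c d e f) (Im c d e f)) ≡.refl
      (seq (re z) n) (seq (im z) n) (seq (re w) n) (seq (im w) n) (seq (re v) n) (seq (im v) n))
    (λ n → solve 6 (λ a b c d e f →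
        Im (Re a b c d) (Im a b c d) e f := Im a b (Re c d e f) (Im c d e f)) ≡.refl
      (seq (re z) n) (seq (im z) n) (seq (re w) n) (seq (im w) n) (seq (re v) n) (seq (im v) n))

  *-identityˡℂ : ∀ z → 1ℂ * z ≈ z
  *-identityˡℂ z = termwise (1ℂ * z) z
    (λ n → solve 2 (λ a b → Re (con 1ℚ) (con 0ℚ) a b := a) ≡.refl
      (seq (re z) n) (seq (im z) n))
    (λ n → solve 2 (λ a b → Im (con 1ℚ) (con 0ℚ) a b := b) ≡.refl
      (seq (re z) n) (seq (im z) n))

  *-distribˡ-+ℂ : ∀ z w v → z * (w + v) ≈ z * w + z * v
  *-distribˡ-+ℂ z w v = termwise (z * (w + v)) (z * w + z * v)
    (λ n → solve 6 (λ a b c d e f → Re a b (c :+ e) (d :+ f) := Re a b c d :+ Re a b e f) ≡.refl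
      (seq (re z) n) (seq (im z) n) (seq (re w) n) (seq (im w) n) (seq (re v) n) (seq (im v) n))
    (λ n → solve 6 (λ a b c d e f → Im a b (c :+ e) (d :+ f) := Im a b c d :+ Im a b e f) ≡.refl
      (seq (re z) n) (seq (im z) n) (seq (re w) n) (seq (im w) n) (seq (re v) n) (seq (im v) n))

  *-commℂ : ∀ z w → z * w ≈ w * z
  *-commℂ z w = termwise (z * w) (w * z)
    (λ n → solve 4 (λ a b c d → Re a b c d := Re c d a b) ≡.refl
      (seq (re z) n) (seq (im z) n) (seq (re w) n) (seq (im w) n))
    (λ n → solve 4 (λ a b c d → Im a b c d := Im c d a b) ≡.refl
      (seq (re z) n) (seq (im z) n) (seq (re w) n) (seq (im w) n))

≈-setoid : Setoid 0ℓ 0ℓ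
≈-setoid = record
  { Carrier = ℂ ; _≈_ = _≈_
  ; isEquivalence = record
    { refl  = λ {z} → ≈ᵣ-refl {re z} , ≈ᵣ-refl {im z}
    ; sym   = λ {z} {w} (p , q) → ≈ᵣ-sym {re z} {re w} p , ≈ᵣ-sym {im z} {im w} q
    ; trans = λ {z} {w} {v} (p , q) (r , s) →
        ≈ᵣ-trans {re z} {re w} {re v} p r , ≈ᵣ-trans {im z} {im w} {im v} q s
    }
  }

+-congℂ : ∀ {z z′ w w′} → z ≈ z′ → w ≈ w′ → z + w ≈ z′ + w′
+-congℂ {z} {z′} {w} {w′} (p , q) (r , s) =
  +ᵣ-cong {re z} {re z′} {re w} {re w′} p r , +ᵣ-cong {im z} {im z′} {im w} {im w′} q s

*-congℂ : ∀ {z z′ w w′} → z ≈ z′ → w ≈ w′ → z * w ≈ z′ * w′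
*-congℂ {z} {z′} {w} {w′} (p , q) (r , s) =
  +ᵣ-cong {re z *ᵣ re w} {re z′ *ᵣ re w′} { -ᵣ (im z *ᵣ im w)} { -ᵣ (im z′ *ᵣ im w′)}
    (*ᵣ-cong {re z} {re z′} {re w} {re w′} p r)
    (-ᵣ-cong {im z *ᵣ im w} {im z′ *ᵣ im w′} (*ᵣ-cong {im z} {im z′} {im w} {im w′} q s)) ,
  +ᵣ-cong {re z *ᵣ im w} {re z′ *ᵣ im w′} {im z *ᵣ re w} {im z′ *ᵣ re w′}
    (*ᵣ-cong {re z} {re z′} {im w} {im w′} p s)
    (*ᵣ-cong {im z} {im z′} {re w} {re w′} q r)

ℂ-commutativeRing : CommutativeRing 0ℓ 0ℓ
ℂ-commutativeRing = record
  { Carrier = ℂ ; _≈_ = _≈_ ; _+_ = _+_ ; _*_ = _*_ ; -_ = -_ ; 0# = 0ℂ ; 1# = 1ℂ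
  ; isCommutativeRing = record
    { isRing = record
      { +-isAbelianGroup = record
        { isGroup = record
          { isMonoid = record
            { isSemigroup = record
              { isMagma = record
                { isEquivalence = Setoid.isEquivalence ≈-setoid
                ; ∙-cong = λ {z} {z′} {w} {w′} → +-congℂ {z} {z′} {w} {w′}
                }
              ; assoc = λ z w v → termwise ((z + w) + v) (z + (w + v))
                  (λ n → ℚₚ.+-assoc (seq (re z) n) (seq (re w) n) (seq (re v) n))
                  (λ n → ℚₚ.+-assoc (seq (im z) n) (seq (im w) n) (seq (im v) n))
              }
            ; identity = comm∧idˡ⇒id ≈-setoid {_∙_ = _+_} +-commℂ {0ℂ} λ z → termwise (0ℂ + z) z
                (λ n → ℚₚ.+-identityˡ (seq (re z) n)) (λ n → ℚₚ.+-identityˡ (seq (im z) n))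
            }
          ; inverse = comm∧invˡ⇒inv ≈-setoid {_∙_ = _+_} { -_} {0ℂ} +-commℂ λ z → termwise (- z + z) 0ℂ
              (λ n → ℚₚ.+-inverseˡ (seq (re z) n)) (λ n → ℚₚ.+-inverseˡ (seq (im z) n))
          ; ⁻¹-cong = λ {z} {w} (p , q) → -ᵣ-cong {re z} {re w} p , -ᵣ-cong {im z} {im w} q
          }
        ; comm = +-commℂ
        }
      ; *-cong = λ {z} {z′} {w} {w′} → *-congℂ {z} {z′} {w} {w′}
      ; *-assoc = *-assocℂ
      ; *-identity = comm∧idˡ⇒id ≈-setoid {_∙_ = _*_} *-commℂ {1ℂ} *-identityˡℂ
      ; distrib = comm∧distrˡ⇒distr ≈-setoid {_*_} {_+_}
          (λ {z} {z′} {w} {w′} → +-congℂ {z} {z′} {w} {w′}) *-commℂ *-distribˡ-+ℂ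
      }
    ; *-comm = *-commℂ
    }
  }
  where
  +-commℂ : ∀ z w → z + w ≈ w + z
  +-commℂ z w = termwise (z + w) (w + z)
    (λ n → ℚₚ.+-comm (seq (re z) n) (seq (re w) n))
    (λ n → ℚₚ.+-comm (seq (im z) n) (seq (im w) n))

ℚ⇒ℂ-homomorphism : ℚ-rawRing -Raw-AlmostCommutative⟶ fromCommutativeRing ℂ-commutativeRing
ℚ⇒ℂ-homomorphism = record
  { ⟦_⟧    = ℚ⇒ℂ
  ; +-homo = λ p q → termwise (ℚ⇒ℂ (p ℚ.+ q)) (ℚ⇒ℂ p + ℚ⇒ℂ q) (λ _ → ≡.refl) (λ _ → ≡.refl)
  ; *-homo = λ p q → termwise (ℚ⇒ℂ (p ℚ.* q)) (ℚ⇒ℂ p * ℚ⇒ℂ q)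
      (λ _ → solve 2 (λ a b → a :* b := a :* b :- con 0ℚ :* con 0ℚ) ≡.refl p q)
      (λ _ → solve 2 (λ a b → con 0ℚ := a :* con 0ℚ :+ con 0ℚ :* b) ≡.refl p q)
  ; -‿homo = λ p → termwise (ℚ⇒ℂ (ℚ.- p)) (- ℚ⇒ℂ p) (λ _ → ≡.refl) (λ _ → ≡.refl)
  ; 0-homo = termwise 0ℂ 0ℂ (λ _ → ≡.refl) (λ _ → ≡.refl)
  ; 1-homo = termwise 1ℂ 1ℂ (λ _ → ≡.refl) (λ _ → ≡.refl)
  }
  where open +-*-Solver

-- Nilpotents and idempotents of ℂ

0≤p² : ∀ p → 0ℚ ℚ.≤ p ℚ.* p
0≤p² p = ≡.subst (0ℚ ℚ.≤_) (square (ℚₚ.∣p∣≡p∨∣p∣≡-p p))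
  (ℚₚ.nonNegative⁻¹ (∣ p ∣ ℚ.* ∣ p ∣)
    {{ℚₚ.nonNeg*nonNeg⇒nonNeg (∣ p ∣) {{ℚₚ.∣-∣-nonNeg p}} (∣ p ∣) {{ℚₚ.∣-∣-nonNeg p}}}})
  where
  open +-*-Solver
  square : ∣ p ∣ ≡ p ⊎ ∣ p ∣ ≡ ℚ.- p → ∣ p ∣ ℚ.* ∣ p ∣ ≡ p ℚ.* p
  square (inj₁ eq) = ≡.cong (λ q → q ℚ.* q) eq
  square (inj₂ eq) = ≡.trans (≡.cong (λ q → q ℚ.* q) eq)
    (solve 1 (λ q → (:- q) :* (:- q) := q :* q) ≡.refl p)

∣p∣≤∣p+q∣ : ∀ p q → 0ℚ ℚ.≤ p → 0ℚ ℚ.≤ q → ∣ p ∣ ℚ.≤ ∣ p ℚ.+ q ∣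
∣p∣≤∣p+q∣ p q 0≤p 0≤q = begin
  ∣ p ∣         ≡⟨ ℚₚ.0≤p⇒∣p∣≡p 0≤p ⟩
  p             ≡⟨ ℚₚ.+-identityʳ p ⟨
  p ℚ.+ 0ℚ      ≤⟨ ℚₚ.+-monoʳ-≤ p 0≤q ⟩
  p ℚ.+ q       ≡⟨ ℚₚ.0≤p⇒∣p∣≡p (ℚₚ.+-mono-≤ 0≤p 0≤q) ⟨
  ∣ p ℚ.+ q ∣   ∎
  where open ℚₚ.≤-Reasoning

∣p∣≤∣p*q∣ : ∀ p q → 1ℚ ℚ.≤ q → ∣ p ∣ ℚ.≤ ∣ p ℚ.* q ∣
∣p∣≤∣p*q∣ p q 1≤q = begin
  ∣ p ∣               ≡⟨ ℚₚ.*-identityʳ ∣ p ∣ ⟨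
  ∣ p ∣ ℚ.* 1ℚ        ≤⟨ ℚₚ.*-monoˡ-≤-nonNeg ∣ p ∣ {{ℚₚ.∣-∣-nonNeg p}} 1≤q ⟩
  ∣ p ∣ ℚ.* q         ≡⟨ ≡.cong (∣ p ∣ ℚ.*_) (ℚₚ.0≤p⇒∣p∣≡p (ℚₚ.≤-trans (ℚₚ.nonNegative⁻¹ 1ℚ) 1≤q)) ⟨
  ∣ p ∣ ℚ.* ∣ q ∣     ≡⟨ ℚₚ.∣p*q∣≡∣p∣*∣q∣ p q ⟨
  ∣ p ℚ.* q ∣         ∎
  where open ℚₚ.≤-Reasoning

p≤∣p∣ : ∀ p → p ℚ.≤ ∣ p ∣
p≤∣p∣ p with ℚₚ.≤-total 0ℚ p
... | inj₁ 0≤p = ℚₚ.≤-reflexive (≡.sym (ℚₚ.0≤p⇒∣p∣≡p 0≤p))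
... | inj₂ p≤0 = ℚₚ.≤-trans p≤0 (ℚₚ.0≤∣p∣ p)

null-const* : ∀ c {u} → Null u → Null (λ n → c ℚ.* u n)
null-const* c = real*null (ℚ⇒ℝ c)

null-minus-0 : ∀ {u} → Null u → Null (λ n → u n ℚ.- 0ℚ)
null-minus-0 {u} = null-ext (λ n → ℚₚ.+-identityʳ (u n))

-- For z = a + bi, (a² + b²)² is the sum of the squares of the real and imaginary parts of z², hence
-- null. So a² + b² is null, and it dominates a² and b².
ℂ-reduced : ∀ z → z * z ≈ 0ℂ → z ≈ 0ℂ
ℂ-reduced z (re≈0 , im≈0) = null-minus-0 a→0 , null-minus-0 b→0
  where
  open +-*-Solver
  a b : ℕ → ℚ
  a = seq (re z)
  b = seq (im z)
  ∣z∣⁴ : ∀ a b → (a ℚ.* a ℚ.+ b ℚ.* b) ℚ.* (a ℚ.* a ℚ.+ b ℚ.* b) ≡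
    (a ℚ.* a ℚ.- b ℚ.* b) ℚ.* (a ℚ.* a ℚ.- b ℚ.* b ℚ.- 0ℚ)
    ℚ.+ (a ℚ.* b ℚ.+ b ℚ.* a) ℚ.* (a ℚ.* b ℚ.+ b ℚ.* a ℚ.- 0ℚ)
  ∣z∣⁴ = solve 2 (λ a b → (a :* a :+ b :* b) :* (a :* a :+ b :* b) :=
    (a :* a :- b :* b) :* (a :* a :- b :* b :- con 0ℚ)
    :+ (a :* b :+ b :* a) :* (a :* b :+ b :* a :- con 0ℚ)) ≡.refl
  norm→0 : Null (λ n → a n ℚ.* a n ℚ.+ b n ℚ.* b n)
  norm→0 = null-√ (null-ext (λ n → ∣z∣⁴ (a n) (b n))
    (null-+ (real*null (re (z * z)) re≈0) (real*null (im (z * z)) im≈0)))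
  a→0 : Null a
  a→0 = null-√ (null-dominated 0
    (λ n _ → ∣p∣≤∣p+q∣ (a n ℚ.* a n) (b n ℚ.* b n) (0≤p² (a n)) (0≤p² (b n))) norm→0)
  b→0 : Null b
  b→0 = null-√ (null-dominated 0
    (λ n _ → ∣p∣≤∣p+q∣ (b n ℚ.* b n) (a n ℚ.* a n) (0≤p² (b n)) (0≤p² (a n)))
    (null-ext (λ n → ℚₚ.+-comm (b n ℚ.* b n) (a n ℚ.* a n)) norm→0))

-- Past `N` the terms stay within 1/4 of `a N`, so comparing `a N` with ½ decides. If it is at most
-- ½, then 4 (1 - a) ≥ 1 and ∣a∣ ≤ ∣4 a (1 - a)∣; otherwise 4 a ≥ 1 and ∣a - 1∣ ≤ ∣4 a (a - 1)∣.
cauchy-idempotent : ∀ a → IsCauchy a → Null (λ n → a n ℚ.* a n ℚ.- a n) →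
  Null a ⊎ Null (λ n → a n ℚ.- 1ℚ)
cauchy-idempotent a a-cauchy a²-a→0 with a-cauchy (+ 1 / 4) (ℚₚ.positive⁻¹ (+ 1 / 4))
... | N , close with ℚₚ.≤-total (a N) ½
... | inj₁ aN≤½ = inj₁ (null-dominated N (λ n N≤n → ∣p∣≤∣p*q∣ (a n) (4ℚ ℚ.* (1ℚ ℚ.- a n)) (begin
    -- This constant evaluates to `1ℚ`, as does its counterpart in the other case.
    4ℚ ℚ.* (1ℚ ℚ.- (½ ℚ.+ + 1 / 4))
      ≤⟨ ℚₚ.*-monoˡ-≤-nonNeg 4ℚ (ℚₚ.+-monoʳ-≤ 1ℚ (ℚₚ.neg-antimono-≤ (a≤ n N≤n))) ⟩
    4ℚ ℚ.* (1ℚ ℚ.- a n) ∎))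
    (null-ext (λ n → solve 1 (λ x → x :* (con 4ℚ :* (con 1ℚ :- x)) := con (ℚ.- 4ℚ) :* (x :* x :- x)) ≡.refl (a n))
      (null-const* (ℚ.- 4ℚ) a²-a→0)))
  where
  open ℚₚ.≤-Reasoning
  open +-*-Solver
  4ℚ = + 4 / 1
  a≤ : ∀ n → N ℕ.≤ n → a n ℚ.≤ ½ ℚ.+ + 1 / 4
  a≤ n N≤n = begin
    a n                       ≡⟨ split (a n) (a N) ⟩
    a N ℚ.+ (a n ℚ.- a N)     ≤⟨ ℚₚ.+-mono-≤ aN≤½ (ℚₚ.≤-trans (p≤∣p∣ _) (ℚₚ.<⇒≤ (close n N N≤n ℕₚ.≤-refl))) ⟩
    ½ ℚ.+ + 1 / 4             ∎
... | inj₂ ½≤aN = inj₂ (null-dominated N (λ n N≤n → ∣p∣≤∣p*q∣ (a n ℚ.- 1ℚ) (4ℚ ℚ.* a n) (begin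
    4ℚ ℚ.* (½ ℚ.- + 1 / 4)
      ≤⟨ ℚₚ.*-monoˡ-≤-nonNeg 4ℚ (≤a n N≤n) ⟩
    4ℚ ℚ.* a n ∎))
    (null-ext (λ n → solve 1 (λ x → (x :- con 1ℚ) :* (con 4ℚ :* x) := con 4ℚ :* (x :* x :- x)) ≡.refl (a n))
      (null-const* 4ℚ a²-a→0)))
  where
  open ℚₚ.≤-Reasoning
  open +-*-Solver
  4ℚ = + 4 / 1
  ≤a : ∀ n → N ℕ.≤ n → ½ ℚ.- + 1 / 4 ℚ.≤ a n
  ≤a n N≤n = begin
    ½ ℚ.- + 1 / 4
      ≤⟨ ℚₚ.+-mono-≤ ½≤aN (ℚₚ.neg-antimono-≤ (ℚₚ.≤-trans (p≤∣p∣ _) (ℚₚ.<⇒≤ (close N n ℕₚ.≤-refl N≤n)))) ⟩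
    a N ℚ.- (a N ℚ.- a n)
      ≡⟨ solve 2 (λ x y → x :- (x :- y) := y) ≡.refl (a N) (a n) ⟩
    a n ∎

-- The imaginary part is shown null first, since b² ≤ b² + 4 b⁴ and the latter is null. Then a² - a
-- is null as well, which reduces the claim to a real idempotent.
ℂ-idempotent : ∀ z → z * z ≈ z → z ≈ 0ℂ ⊎ z ≈ 1ℂ
ℂ-idempotent z (re≈ , im≈) = decide (cauchy-idempotent a (cauchy (re z)) a²-a→0)
  where
  open +-*-Solver
  a b : ℕ → ℚ
  a = seq (re z)
  b = seq (im z)
  2ℚ 4ℚ : ℚ
  2ℚ = + 2 / 1
  4ℚ = + 4 / 1
  -- The right-hand side is v² − 4 b² u, where u and v = (2a − 1) b are the real
  -- and imaginary parts of z² − z.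
  b²+4b⁴ : ∀ a b → b ℚ.* b ℚ.+ (2ℚ ℚ.* (b ℚ.* b)) ℚ.* (2ℚ ℚ.* (b ℚ.* b)) ≡
    (a ℚ.* b ℚ.+ b ℚ.* a ℚ.- b) ℚ.* (a ℚ.* b ℚ.+ b ℚ.* a ℚ.- b)
    ℚ.+ (ℚ.- 4ℚ ℚ.* (b ℚ.* b)) ℚ.* (a ℚ.* a ℚ.- b ℚ.* b ℚ.- a)
  b²+4b⁴ = solve 2 (λ a b → b :* b :+ (con 2ℚ :* (b :* b)) :* (con 2ℚ :* (b :* b)) :=
    (a :* b :+ b :* a :- b) :* (a :* b :+ b :* a :- b)
    :+ (con (ℚ.- 4ℚ) :* (b :* b)) :* (a :* a :- b :* b :- a)) ≡.refl
  b→0 : Null b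
  b→0 = null-√ (null-dominated 0
    (λ n _ → ∣p∣≤∣p+q∣ (b n ℚ.* b n) ((2ℚ ℚ.* (b n ℚ.* b n)) ℚ.* (2ℚ ℚ.* (b n ℚ.* b n)))
      (0≤p² (b n)) (0≤p² (2ℚ ℚ.* (b n ℚ.* b n))))
    (null-ext (λ n → b²+4b⁴ (a n) (b n))
      (null-+ (real*null (im (z * z) -ᵣ im z) im≈)
              (real*null (ℚ⇒ℝ (ℚ.- 4ℚ) *ᵣ (im z *ᵣ im z)) re≈))))
  a²-a→0 : Null (λ n → a n ℚ.* a n ℚ.- a n)
  a²-a→0 = null-ext (λ n → solve 2 (λ a b → a :* a :- a := (a :* a :- b :* b :- a) :+ b :* b)
      ≡.refl (a n) (b n))
    (null-+ re≈ (real*null (im z) b→0))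
  decide : Null a ⊎ Null (λ n → a n ℚ.- 1ℚ) → z ≈ 0ℂ ⊎ z ≈ 1ℂ
  decide (inj₁ a→0) = inj₁ (null-minus-0 a→0 , null-minus-0 b→0)
  decide (inj₂ a→1) = inj₂ (a→1 , null-minus-0 b→0)

mainTheorem1 :
  (k : ℕ) (k≥3 : k ≥ 3) →
  let instance
        k≢0 = >-nonZero (≤-trans (s≤s z≤n) k≥3)
  in
  (f : ℕ⁺ → ℂ) →
  ((x : Vector ℕ⁺ k) → f (sumOfSquares x) ≈ ∑ (λ i → f (x i) ²)) →
  ((n : ℕ⁺) → f n ≈ 0ℂ)
  ⊎ ((n : ℕ⁺) →
      (IsSumOfSquares k n → f n ≈ ℕ⁺⇒ℂ n)
      × (¬ IsSumOfSquares k n → f n ≈ ℕ⁺⇒ℂ n ⊎ f n ≈ - ℕ⁺⇒ℂ n))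
  ⊎ ((n : ℕ⁺) →
      (IsSumOfSquares k n → f n ≈ 1/ℂ k)
      × (¬ IsSumOfSquares k n → f n ≈ 1/ℂ k ⊎ f n ≈ - 1/ℂ k))
mainTheorem1 (suc (suc (suc m))) (s≤s (s≤s (s≤s z≤n))) f f-sum =
  -- Once `k` is `3 + m`, the terms `∑`, `_²`, `ℕ⁺⇒ℂ` and `1/ℂ` unfold to their counterparts in the
  -- abstract ℚ-algebra.
  Sum.map id (Sum.map (forget ℕ⁺⇒ℂ) (forget (λ _ → 1/ℂ (3 ℕ.+ m))))
    (classification ℂ-idempotent ℂ-reduced)
  where
  open ℚ-Algebra ℂ-commutativeRing ℚ⇒ℂ-homomorphism using (module Additive)
  open Additive m f f-sum
  forget : ∀ h → IsClassifiedBy h → (n : ℕ⁺) →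
    (IsSumOfSquares (3 ℕ.+ m) n → f n ≈ h n)
    × (¬ IsSumOfSquares (3 ℕ.+ m) n → f n ≈ h n ⊎ f n ≈ - h n)
  forget h c n = proj₁ (c n) , λ _ → proj₂ (c n)
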